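{- Simple type theory with a parametric quantifier, i.e. the following theory of the $\lambda\Pi$-calculus modulo theory, is super-consistent. Constants: $$type:Type,\quad \iota:type,\quad o:type,\quad arrow:type\to type\to type,\quad \eta:type\to Type,$$ $${\Rightarrow}:(\eta\,o)\to(\eta\,o)\to(\eta\,o),\quad \forall:\Pi a:type\;(((\eta\,a)\to(\eta\,o))\to(\eta\,o)),\quad \varepsilon:(\eta\,o)\to Type;$$ rewrite rules: $$(\eta\,(arrow\,x\,y))\longrightarrow(\eta\,x)\to(\eta\,y),\qquad (\varepsilon\,({\Rightarrow}\,x\,y))\longrightarrow(\varepsilon\,x)\to(\varepsilon\,y),$$ $$(\varepsilon\,(\forall\,x\,y))\longrightarrow\Pi z:(\eta\,x)\;(\varepsilon\,(y\,z)),$$ in the rule contexts $x:type,\,y:type$; $x:(\eta\,o),\,y:(\eta\,o)$; and $x:type,\,y:(\eta\,x)\to(\eta\,o)$ respectively.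
   Context: **Terms.** Terms are $t ::= x\mid Type\mid Kind\mid \Pi x:t\;t\mid\lambda x:t\;t\mid t\,t$, up to $\alpha$-equivalence; $(u/x)t$ is capture-avoiding substitution; $A\to B$ is $\Pi x:A\;B$ with $x$ not free in $B$. $\beta$ is root $\beta$-reduction. For a relation $r$ on terms, $\longrightarrow^1_r$ is its closure under term formation, $\longrightarrow^*_r$ the reflexive-transitive closure of $\longrightarrow_r^1$, and $\equiv_r$ its reflexive-symmetric-transitive closure. **Theories.** A rewrite rule is a triple $l\longrightarrow^{\Gamma}r$ with $\Gamma$ a context and $l,r$ $\beta$-normal; it is well-typed in a context $\Sigma$ if, in the $\lambda\Pi$-calculus, $\Sigma,\Gamma$ is well-formed and $l,r$ have a common type $A$ in $\Sigma,\Gamma$. A theory $\Sigma,\mathcal R$ is a context $\Sigma$ well-formed in the $\lambda\Pi$-calculus (its variables are called constants) and a set $\mathcal R$ of rewrite rules well-typed in $\Sigma$. $t\,\mathcal R\,u$ (root reduction) means $t=\theta l$, $u=\theta r$ for some rule $l\longrightarrow^\Gamma r$ and substitution $\theta$ of the variables of $\Gamma$. $\beta\mathcal R$ is the union of $\beta$ and $\mathcal R$. **Typing in the $\lambda\Pi$-calculus modulo $\Sigma,\mathcal R$.** (Empty) $[\,]$ is well-formed. (Declaration) if $\Gamma\vdash A:Type$ or $\Gamma\vdash A:Kind$, and $x\notin\Sigma,\Gamma$, then $\Gamma,x:A$ is well-formed. (Sort) if $\Gamma$ is well-formed, $\Gamma\vdash Type:Kind$. (Variable) if $\Gamma$ is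 well-formed and $x:A\in\Sigma,\Gamma$ then $\Gamma\vdash x:A$. For $s\in\{Type,Kind\}$: (Product) if $\Gamma\vdash A:Type$ and $\Gamma,x:A\vdash B:s$ then $\Gamma\vdash\Pi x:A\;B:s$; (Abstraction) if moreover $\Gamma,x:A\vdash t:B$ then $\Gamma\vdash\lambda x:A\;t:\Pi x:A\;B$. (Application) if $\Gamma\vdash t:\Pi x:A\;B$ and $\Gamma\vdash u:A$ then $\Gamma\vdash(t\,u):(u/x)B$. (Conversion) for $s\in\{Type,Kind\}$, if $\Gamma\vdash A:s$, $\Gamma\vdash B:s$, $\Gamma\vdash t:A$ and $A\equiv_{\beta\mathcal R}B$ then $\Gamma\vdash t:B$. The plain $\lambda\Pi$-calculus is the case where $\Sigma$ and $\mathcal R$ are empty. Throughout, $\longrightarrow^1_{\beta\mathcal R}$ is assumed confluent and to have the subject reduction property. **$\Pi$-algebras.** A $\Pi$-algebra is a set $\mathcal B$ with a pre-order $\le$, an element $\tilde\top$, a function $\tilde\wedge:\mathcal B\times\mathcal B\to\mathcal B$, a subset $\mathcal A$ of the set $\mathcal P^+(\mathcal B)$ of non-empty subsets of $\mathcal B$, and a function $\tilde\Pi:\mathcal B\times\mathcal A\to\mathcal B$, such that $a\le\tilde\top$ for all $a$; $a\,\tilde\wedge\,b$ is a greatest lower bound of $\{a,b\}$; and $a\le\tilde\Pi(b,S)$ iff $a\,\tilde\wedge\,b\le c$ for all $c\in S$. It is full if $\mathcal A=\mathcal P^+(\mathcal B)$. It is ordered if equipped with an order relation $\sqsubseteq$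 on $\mathcal B$ such that $a\sqsubseteq b$ implies $\tilde\Pi(b,S)\sqsubseteq\tilde\Pi(a,S)$ for all $S$, and $S\sqsubseteq T$ implies $\tilde\Pi(a,S)\sqsubseteq\tilde\Pi(a,T)$ for all $a$, where $S\sqsubseteq T$ means that for all $a\in S$ there is $b\in T$ with $a\sqsubseteq b$. An ordered $\Pi$-algebra is complete if every subset of $\mathcal B$ has a least upper bound for $\sqsubseteq$. **Models.** A model is a family $\mathcal D^1,\dots,\mathcal D^n$ ($n\ge2$) of functions. $\mathcal D^i$ maps each term $t$ of type $B$ in some context $\Gamma$ (in the calculus modulo $\Sigma,\mathcal R$), and valuations $\phi_1,\dots,\phi_{i-1}$, where $\phi_j$ maps each $x:A$ of $\Gamma$ to an element of $\mathcal D^j_{A,\phi_1,\dots,\phi_{j-1}}$, to some $\mathcal D^i_{t,\phi_1,\dots,\phi_{i-1}}$, which for $i\ge2$ lies in $\mathcal D^{i-1}_{B,\phi_1,\dots,\phi_{i-2}}$; the functions are also defined on $Kind$ (without membership condition). The value depends only on $t$ and on the values of the valuations on variables free in $t$. Write $\llbracket t\rrbracket_{\phi_1,\dots,\phi_{n-1}}$ for $\mathcal D^n_{t,\phi_1,\dots,\phi_{n-1}}$. It is required that, for all $t,u$ and valuations (with $u$ of the declared type of $x$), $$\llbracket(u/x)t\rrbracket_{\phi_1,\dots,\phi_{n-1}}=\llbracket t\rrbracket_{(\phi_1,x=\mathcal D^1_u),\dots,(\phi_{n-1},x=\mathcal D^{n-1}_{u,\phi_1,\dots,\phi_{n-2}})}.$$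 The model is valued in $\mathcal B$ if $\mathcal D^{n-1}_{Kind,\phi_1,\dots,\phi_{n-2}}=\mathcal D^{n-1}_{Type,\phi_1,\dots,\phi_{n-2}}=\mathcal B$, $\llbracket Kind\rrbracket_{\overline\phi}=\llbracket Type\rrbracket_{\overline\phi}=\tilde\top$, and $$\llbracket\Pi x:C\;D\rrbracket_{\overline\phi}=\tilde\Pi(\llbracket C\rrbracket_{\overline\phi},\{\llbracket D\rrbracket_{(\phi_1,x=c_1),\dots,(\phi_{n-1},x=c_{n-1})}\mid c_1\in\mathcal D^1_C,\dots,c_{n-1}\in\mathcal D^{n-1}_{C,\phi_1,\dots,\phi_{n-2}}\}).$$ A model valued in $\mathcal B$ is a model of $\Sigma,\mathcal R$ if $\llbracket A\rrbracket\ge\tilde\top$ for every constant $c:A$ in $\Sigma$, and for all $A,B$ well-typed in a context $\Gamma$ with $A\equiv_{\beta\mathcal R}B$, all $i$ and all valuations $\overline\phi$, $\mathcal D^i_{A,\overline\phi}=\mathcal D^i_{B,\overline\phi}$. **Super-consistency.** A theory $\Sigma,\mathcal R$ is super-consistent if, for every full, ordered and complete $\Pi$-algebra $\mathcal B$, there exists a model of $\Sigma,\mathcal R$ valued in $\mathcal B$.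
   Formalization: In the definition of model, the substitution condition is taken with x = D^{j+1}_{u,φ1,…,φj} added to φ_j instead of D^j_u, since φ_j must send x:A into D^j_A, while D^j_u lies in D^{j-1}_A, so the condition as written is ill-defined. -}

module Defs where

open import Data.Fin using (Fin; zero; suc; #_)
open import Data.List.Base using (List; []; _∷_)
open import Data.List.Membership.Propositional using (_∈_)
open import Data.List.Relation.Unary.All using (All; []; _∷_)
open import Data.List.Relation.Unary.Any using (here; there)
open import Data.Nat.Base using (ℕ; zero; suc; _<_)
open import Data.Product.Base using (Σ-syntax; ∃; ∃-syntax; _×_; _,_; proj₁)
open import Data.Vec.Base using (Vec; []; _∷_; zipWith)
open import Data.Vec.Functional using (Vector) renaming (_∷_ to _◂_)
open import Data.Vec.Relation.Binary.Pointwise.Inductive using (Pointwise)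
open import Function.Base using (_∘_)
open import Function.Bundles using (_⇔_)
open import Function.Definitions using (Injective)
open import Level using (0ℓ)
open import Relation.Binary.Construct.Closure.Equivalence using (EqClosure)
open import Relation.Binary.Construct.Union using (_∪_)
open import Relation.Binary.Core using (Rel)
open import Relation.Binary.Definitions using (Maximum)
open import Relation.Binary.Lattice using (Infimum)
open import Relation.Binary.PropositionalEquality.Core using (_≡_; _≢_; refl)
open import Relation.Binary.Rewriting using (Confluent; IsNormalForm)
open import Relation.Binary.Structures using (IsPreorder; IsPartialOrder)
open import Relation.Unary using (Pred; ∅)

------------------------------------------------------------------------
-- Terms

data Sort : Set where
  ⋆ □ : Sort

infixl 9 _·_

-- α-equivalence classes, as well-scoped de Bruijn terms.  The variables
-- declared in Σ are the `con`s; those declared in Γ are the `var`s.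
data Term (C : Set) (k : ℕ) : Set where
  var  : Fin k → Term C k
  con  : C → Term C k
  sort : Sort → Term C k
  Π ƛ  : Term C k → Term C (suc k) → Term C k
  _·_  : Term C k → Term C k → Term C k

pattern Type = sort ⋆
pattern Kind = sort □

module _ {C : Set} where

  infixr 6 _⇛_

  lift : ∀ {k l} → (Fin k → Fin l) → Fin (suc k) → Fin (suc l)
  lift ρ = zero ◂ (suc ∘ ρ)

  rename : ∀ {k l} → (Fin k → Fin l) → Term C k → Term C l
  rename ρ (var x)  = var (ρ x)
  rename ρ (con c)  = con c
  rename ρ (sort s) = sort s
  rename ρ (Π A B)  = Π (rename ρ A) (rename (lift ρ) B)
  rename ρ (ƛ A t)  = ƛ (rename ρ A) (rename (lift ρ) t)
  rename ρ (t · u)  = rename ρ t · rename ρ u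

  weaken : ∀ {k} → Term C k → Term C (suc k)
  weaken = rename suc

  lifts : ∀ {k l} → (Fin k → Term C l) → Fin (suc k) → Term C (suc l)
  lifts θ = var zero ◂ (weaken ∘ θ)

  subst : ∀ {k l} → (Fin k → Term C l) → Term C k → Term C l
  subst θ (var x)  = θ x
  subst θ (con c)  = con c
  subst θ (sort s) = sort s
  subst θ (Π A B)  = Π (subst θ A) (subst (lifts θ) B)
  subst θ (ƛ A t)  = ƛ (subst θ A) (subst (lifts θ) t)
  subst θ (t · u)  = subst θ t · subst θ u

  _[_] : ∀ {k} → Term C (suc k) → Term C k → Term C k
  t [ u ] = subst (u ◂ var) t

  _⇛_ : ∀ {k} → Term C k → Term C k → Term C k
  A ⇛ B = Π A (weaken B)

------------------------------------------------------------------------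
-- Contexts and signatures

infixl 5 _▷_

data Ctx (C : Set) : ℕ → Set where
  []  : Ctx C zero
  _▷_ : ∀ {k} → Ctx C k → Term C k → Ctx C (suc k)

lookup : ∀ {C k} → Ctx C k → Fin k → Term C k
lookup (Γ ▷ A) zero    = weaken A
lookup (Γ ▷ A) (suc x) = weaken (lookup Γ x)

-- The most recent declaration comes first.
Signature : Set → Set
Signature C = List (C × Term C 0)

close : ∀ {C k} → Term C 0 → Term C k
close = rename λ ()

------------------------------------------------------------------------
-- Reduction

TermRel : Set → Set₁
TermRel C = ∀ {k} → Rel (Term C k) 0ℓ

data Closure {C : Set} (r : TermRel C) {k : ℕ} : Rel (Term C k) 0ℓ where
  root : ∀ {t u}    → r t u           → Closure r t u
  Π₁   : ∀ {A A′ B} → Closure r A A′  → Closure r (Π A B) (Π A′ B)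
  Π₂   : ∀ {A B B′} → Closure r B B′  → Closure r (Π A B) (Π A B′)
  ƛ₁   : ∀ {A A′ t} → Closure r A A′  → Closure r (ƛ A t) (ƛ A′ t)
  ƛ₂   : ∀ {A t t′} → Closure r t t′  → Closure r (ƛ A t) (ƛ A t′)
  ·₁   : ∀ {t t′ u} → Closure r t t′  → Closure r (t · u) (t′ · u)
  ·₂   : ∀ {t u u′} → Closure r u u′  → Closure r (t · u) (t · u′)

data β {C : Set} {k : ℕ} : Rel (Term C k) 0ℓ where
  beta : ∀ {A t u} → β (ƛ A t · u) (t [ u ])

βNormal : ∀ {C k} → Term C k → Set
βNormal = IsNormalForm (Closure β)

record Rule (C : Set) : Set where
  field
    {size}     : ℕ
    ctx        : Ctx C size
    lhs rhs    : Term C size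
    lhs-normal : βNormal lhs
    rhs-normal : βNormal rhs

module _ {C : Set} (R : Pred (Rule C) 0ℓ) where

  data RootStep {k : ℕ} : Rel (Term C k) 0ℓ where
    instantiate : ∀ {ϱ} → R ϱ → (θ : Fin (Rule.size ϱ) → Term C k) →
                  RootStep (subst θ (Rule.lhs ϱ)) (subst θ (Rule.rhs ϱ))

  βR-step : TermRel C
  βR-step = Closure (β ∪ RootStep)

  βR-conv : TermRel C
  βR-conv = EqClosure βR-step

------------------------------------------------------------------------
-- The λΠ-calculus modulo (Σ , R)

module Typing {C : Set} (𝕊 : Signature C) (R : Pred (Rule C) 0ℓ) where

  infix 3 _⊢_∶_

  mutual
    data WF : ∀ {k} → Ctx C k → Set where
      empty   : WF []
      declare : ∀ {k} {Γ : Ctx C k} {A} s → Γ ⊢ A ∶ sort s → WF (Γ ▷ A)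

    data _⊢_∶_ {k} (Γ : Ctx C k) : Term C k → Term C k → Set where
      ⊢type : WF Γ → Γ ⊢ Type ∶ Kind
      ⊢var  : WF Γ → ∀ x → Γ ⊢ var x ∶ lookup Γ x
      ⊢con  : ∀ {c A} → WF Γ → (c , A) ∈ 𝕊 → Γ ⊢ con c ∶ close A
      ⊢Π    : ∀ {A B} s → Γ ⊢ A ∶ Type → Γ ▷ A ⊢ B ∶ sort s →
              Γ ⊢ Π A B ∶ sort s
      ⊢ƛ    : ∀ {A B t} s → Γ ⊢ A ∶ Type → Γ ▷ A ⊢ B ∶ sort s →
              Γ ▷ A ⊢ t ∶ B → Γ ⊢ ƛ A t ∶ Π A B
      ⊢·    : ∀ {A B t u} → Γ ⊢ t ∶ Π A B → Γ ⊢ u ∶ A → Γ ⊢ t · u ∶ B [ u ]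
      ⊢conv : ∀ {A B t} s → Γ ⊢ A ∶ sort s → Γ ⊢ B ∶ sort s → Γ ⊢ t ∶ A →
              βR-conv R A B → Γ ⊢ t ∶ B

  -- Kind has no type, but models interpret it too.
  data Expr {k} (Γ : Ctx C k) : Term C k → Set where
    typed : ∀ {t A} → Γ ⊢ t ∶ A → Expr Γ t
    kind  : WF Γ → Expr Γ Kind

-- The context Σ , Γ of the plain calculus is the context Γ of the calculus
-- with constants Σ and no rules, Σ itself being checked by WFSignature.
module Plain {C : Set} (𝕊 : Signature C) = Typing 𝕊 ∅

data WFSignature {C : Set} : Signature C → Set where
  []  : WFSignature []
  add : ∀ {𝕊 c A} s → WFSignature 𝕊 → Plain._⊢_∶_ 𝕊 [] A (sort s) →
        All (λ d → c ≢ proj₁ d) 𝕊 → WFSignature ((c , A) ∷ 𝕊)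

record WellTyped {C : Set} (𝕊 : Signature C) (ϱ : Rule C) : Set where
  open Rule ϱ
  open Plain 𝕊
  field
    ctx-wf      : WF ctx
    common-type : ∃[ A ] (ctx ⊢ lhs ∶ A) × (ctx ⊢ rhs ∶ A)

record Theory : Set₁ where
  field
    Const      : Set
    𝕊          : Signature Const
    R          : Pred (Rule Const) 0ℓ
    𝕊-wf       : WFSignature 𝕊
    well-typed : ∀ {ϱ} → R ϱ → WellTyped 𝕊 ϱ

  open Typing 𝕊 R public

  ConfluentReduction : Set
  ConfluentReduction = ∀ {k} → Confluent (βR-step R {k})

  SubjectReduction : Set
  SubjectReduction = ∀ {k} {Γ : Ctx Const k} {t u A} →
                     Γ ⊢ t ∶ A → βR-step R t u → Γ ⊢ u ∶ A

------------------------------------------------------------------------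
-- Sets

-- In a model, values are at once elements and sets (𝒟ⁱ t belongs to
-- 𝒟ⁱ⁻¹ B), so all of them are drawn from a universe of iterative sets in
-- Aczel's style, with extensional equality.
data 𝕍 : Set₁ where
  sup : (I : Set) → (I → 𝕍) → 𝕍

index : 𝕍 → Set
index (sup I f) = I

elt : (S : 𝕍) → index S → 𝕍
elt (sup I f) = f

infix 4 _≈_ _∈ᵛ_ _⊆ᵛ_

_≈_ : Rel 𝕍 0ℓ
sup I f ≈ sup J g = (∀ i → ∃[ j ] f i ≈ g j) × (∀ j → ∃[ i ] f i ≈ g j)

_∈ᵛ_ : Rel 𝕍 0ℓ
v ∈ᵛ S = ∃[ i ] v ≈ elt S i

_⊆ᵛ_ : Rel 𝕍 0ℓ
S ⊆ᵛ T = ∀ i → elt S i ∈ᵛ T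

------------------------------------------------------------------------
-- Π-algebras

-- Elements of the carrier are given by their indices, two indices being
-- equal when they denote the same set; subsets are sets included in the
-- carrier, and 𝒜 is a class of them.
record ΠAlgebra : Set₁ where
  infix  4 _≈ᴮ_ _≤_
  infixr 7 _∧_
  field
    carrier : 𝕍

  El : Set
  El = index carrier

  ⟪_⟫ : El → 𝕍
  ⟪_⟫ = elt carrier

  _≈ᴮ_ : Rel El 0ℓ
  a ≈ᴮ b = ⟪ a ⟫ ≈ ⟪ b ⟫

  𝒫⁺ : 𝕍 → Set
  𝒫⁺ S = S ⊆ᵛ carrier × index S

  field
    _≤_        : Rel El 0ℓ
    isPreorder : IsPreorder _≈ᴮ_ _≤_
    ⊤̃          : El
    _∧_        : El → El → El
    ∧-cong     : ∀ {a a′ b b′} → a ≈ᴮ a′ → b ≈ᴮ b′ → a ∧ b ≈ᴮ a′ ∧ b′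
    𝒜          : 𝕍 → Set
    𝒜-resp     : ∀ {S T} → S ≈ T → 𝒜 S → 𝒜 T
    𝒜⊆𝒫⁺       : ∀ {S} → 𝒜 S → 𝒫⁺ S
    Π̃          : El → (S : 𝕍) → 𝒜 S → El
    Π̃-cong     : ∀ {a b S T} (p : 𝒜 S) (q : 𝒜 T) →
                 a ≈ᴮ b → S ≈ T → Π̃ a S p ≈ᴮ Π̃ b T q
    ⊤̃-maximum  : Maximum _≤_ ⊤̃
    ∧-infimum  : Infimum _≤_ _∧_
    Π̃-spec     : ∀ a b S (p : 𝒜 S) →
                 a ≤ Π̃ b S p ⇔ (∀ c → ⟪ c ⟫ ∈ᵛ S → a ∧ b ≤ c)

  Full : Set₁
  Full = ∀ {S} → 𝒫⁺ S → 𝒜 S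

record Ordered (𝓑 : ΠAlgebra) : Set₁ where
  open ΠAlgebra 𝓑
  infix 4 _⊑_ _⊑ˢ_
  field
    _⊑_            : Rel El 0ℓ
    isPartialOrder : IsPartialOrder _≈ᴮ_ _⊑_

  _⊑ˢ_ : Rel 𝕍 0ℓ
  S ⊑ˢ T = ∀ a → ⟪ a ⟫ ∈ᵛ S → ∃[ b ] ⟪ b ⟫ ∈ᵛ T × a ⊑ b

  field
    Π̃-antitone : ∀ {a b} S (p : 𝒜 S) → a ⊑ b → Π̃ b S p ⊑ Π̃ a S p
    Π̃-monotone : ∀ a {S T} (p : 𝒜 S) (q : 𝒜 T) →
                 S ⊑ˢ T → Π̃ a S p ⊑ Π̃ a T q

  Complete : Set₁
  Complete = ∀ S → S ⊆ᵛ carrier →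
             ∃[ a ] (∀ b → ⟪ b ⟫ ∈ᵛ S → b ⊑ a)
                  × (∀ c → (∀ b → ⟪ b ⟫ ∈ᵛ S → b ⊑ c) → a ⊑ c)

------------------------------------------------------------------------
-- Models

-- A sequence of valuations φ₁ , … , φᵢ of the variables of a context of
-- length k, with φᵢ at the head.
Valuations : ℕ → ℕ → Set₁
Valuations k i = Vec (Vector 𝕍 k) i

-- (φ₁ , x = c₁) , … , (φᵢ , x = cᵢ)
extend : ∀ {k i} → Valuations k i → Vec 𝕍 i → Valuations (suc k) i
extend = zipWith λ φ c → c ◂ φ

-- 𝒟 i is the function 𝒟ⁱ⁺¹, which takes i valuations.
module Interpretation {C : Set}
                      (𝒟 : ∀ i {k} → Term C k → Valuations k i → 𝕍) where

  -- φⱼ x ∈ 𝒟ʲ (A , φ₁ , … , φⱼ₋₁) for each x : A in Γ and each j ≤ i.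
  data Valid {k} (Γ : Ctx C k) : ∀ {i} → Valuations k i → Set₁ where
    []  : Valid Γ []
    _∷_ : ∀ {i φ} {φs : Valuations k i} →
          (∀ x → φ x ∈ᵛ 𝒟 i (lookup Γ x) φs) → Valid Γ φs → Valid Γ (φ ∷ φs)

  -- cⱼ ∈ 𝒟ʲ (A , φ₁ , … , φⱼ₋₁) for each j ≤ i.
  data Range {k} (A : Term C k) :
             ∀ {i} → Valuations k i → Vec 𝕍 i → Set₁ where
    []  : Range A [] []
    _∷_ : ∀ {i φ c} {φs : Valuations k i} {cs} →
          c ∈ᵛ 𝒟 i A φs → Range A φs cs → Range A (φ ∷ φs) (c ∷ cs)

  -- The values of u as a tuple of elements for a variable of its type: an
  -- element of 𝒟ʲ A is provided by 𝒟ʲ⁺¹ u, so the j-th value is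
  -- 𝒟ʲ⁺¹ (u , φ₁ , … , φⱼ).
  values : ∀ {k i} → Term C k → Valuations k i → Vec 𝕍 i
  values             u []       = []
  values {i = suc i} u (φ ∷ φs) = 𝒟 (suc i) u (φ ∷ φs) ∷ values u φs

record Model (T : Theory) : Set₁ where
  open Theory T
  field
    m : ℕ

  n : ℕ
  n = suc (suc m)

  -- Terms outside the domain of definition get irrelevant values, and so do
  -- all terms when i ≥ n: the conditions below only bear on 𝒟¹ , … , 𝒟ⁿ,
  -- on Kind and typed terms, and on valid valuations.
  field
    𝒟 : ∀ i {k} → Term Const k → Valuations k i → 𝕍

  open Interpretation 𝒟 public

  ⟦_⟧ : ∀ {k} → Term Const k → Valuations k (suc m) → 𝕍
  ⟦_⟧ = 𝒟 (suc m)

  field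
    member : ∀ {i} → suc i < n →
             ∀ {k} {Γ : Ctx Const k} {t B} → Γ ⊢ t ∶ B →
             ∀ {φ φs} → Valid Γ (φ ∷ φs) →
             𝒟 (suc i) t (φ ∷ φs) ∈ᵛ 𝒟 i B φs

    -- The same named term living in two contexts Γ and Δ is represented by
    -- two renamings of one term t, whose scope may be taken to consist of
    -- its free variables only.
    local : ∀ {i} → i < n →
            ∀ {j k l} {Γ : Ctx Const k} {Δ : Ctx Const l} (t : Term Const j)
              {ρ : Fin j → Fin k} {σ : Fin j → Fin l} →
            Injective _≡_ _≡_ ρ → Injective _≡_ _≡_ σ →
            Expr Γ (rename ρ t) → Expr Δ (rename σ t) →
            ∀ {φs : Valuations k i} {ψs : Valuations l i} →
            Valid Γ φs → Valid Δ ψs →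
            Pointwise (λ φ ψ → ∀ x → φ (ρ x) ≈ ψ (σ x)) φs ψs →
            𝒟 i (rename ρ t) φs ≈ 𝒟 i (rename σ t) ψs

    substitution : ∀ {k} {Γ : Ctx Const k} {A t u} →
                   Expr (Γ ▷ A) t → Γ ⊢ u ∶ A →
                   ∀ {φs} → Valid Γ φs →
                   ⟦ t [ u ] ⟧ φs ≈ ⟦ t ⟧ (extend φs (values u φs))

record ValuedIn {T : Theory} (𝓑 : ΠAlgebra) (M : Model T) : Set₁ where
  open Theory T
  open ΠAlgebra 𝓑
  open Model M
  field
    sort-carrier : ∀ {k} {Γ : Ctx Const k} → WF Γ → ∀ s {φs} → Valid Γ φs →
                   𝒟 m (sort s) φs ≈ carrier
    sort-value   : ∀ {k} {Γ : Ctx Const k} → WF Γ → ∀ s {φs} → Valid Γ φs →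
                   ⟦ sort s ⟧ φs ≈ ⟪ ⊤̃ ⟫
    Π-value      : ∀ {k} {Γ : Ctx Const k} {A D B} → Γ ⊢ Π A D ∶ B →
                   ∀ {φs} → Valid Γ φs →
                   Σ[ a ∈ El ] Σ[ S ∈ 𝕍 ] Σ[ p ∈ 𝒜 S ]
                     ⟪ a ⟫ ≈ ⟦ A ⟧ φs
                     × (∀ v → v ∈ᵛ S ⇔ (∃[ cs ] Range A φs cs
                                               × v ≈ ⟦ D ⟧ (extend φs cs)))
                     × ⟦ Π A D ⟧ φs ≈ ⟪ Π̃ a S p ⟫

record ModelOf {T : Theory} (𝓑 : ΠAlgebra) (M : Model T) : Set₁ where
  open Theory T
  open ΠAlgebra 𝓑
  open Model M
  field
    constants  : ∀ {c A} → (c , A) ∈ 𝕊 → ∀ φs →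
                 ∃[ a ] ⟪ a ⟫ ≈ ⟦ A ⟧ φs × ⊤̃ ≤ a
    conversion : ∀ {i} → i < n →
                 ∀ {k} {Γ : Ctx Const k} {A B A′ B′} →
                 Γ ⊢ A ∶ A′ → Γ ⊢ B ∶ B′ → βR-conv R A B →
                 ∀ {φs} → Valid Γ φs → 𝒟 i A φs ≈ 𝒟 i B φs

SuperConsistent : Theory → Set₁
SuperConsistent T =
  (𝓑 : ΠAlgebra) → ΠAlgebra.Full 𝓑 →
  (𝓞 : Ordered 𝓑) → Ordered.Complete 𝓞 →
  Σ[ M ∈ Model T ] ValuedIn 𝓑 M × ModelOf 𝓑 M

------------------------------------------------------------------------
-- Simple type theory with a parametric quantifier

data Symbol : Set where
  type ι o arrow η ⇒̇ ∀̇ ε : Symbol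

infixr 8 _⇒′_

η′ ε′ : ∀ {k} → Term Symbol k → Term Symbol k
η′ t = con η · t
ε′ t = con ε · t

arrow′ _⇒′_ ∀′ : ∀ {k} → Term Symbol k → Term Symbol k → Term Symbol k
arrow′ t u = con arrow · t · u
t ⇒′ u     = con ⇒̇ · t · u
∀′ t u     = con ∀̇ · t · u

STT-signature : Signature Symbol
STT-signature =
    (ε     , η′ (con o) ⇛ Type)
  ∷ (∀̇     , Π (con type) ((η′ (var (# 0)) ⇛ η′ (con o)) ⇛ η′ (con o)))
  ∷ (⇒̇     , η′ (con o) ⇛ η′ (con o) ⇛ η′ (con o))
  ∷ (η     , con type ⇛ Type)
  ∷ (arrow , con type ⇛ con type ⇛ con type)
  ∷ (o     , con type)
  ∷ (ι     , con type)
  ∷ (type  , Type)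
  ∷ []

-- In a rule context x , y, the variable x is # 1 and y is # 0.

arrow-rule : Rule Symbol
arrow-rule = record
  { ctx        = [] ▷ con type ▷ con type
  ; lhs        = η′ (arrow′ (var (# 1)) (var (# 0)))
  ; rhs        = η′ (var (# 1)) ⇛ η′ (var (# 0))
  ; lhs-normal = λ where
      (_ , root ())
      (_ , ·₁ (root ()))
      (_ , ·₂ (root ()))
      (_ , ·₂ (·₁ (root ())))
      (_ , ·₂ (·₁ (·₁ (root ()))))
      (_ , ·₂ (·₁ (·₂ (root ()))))
      (_ , ·₂ (·₂ (root ())))
  ; rhs-normal = λ where
      (_ , root ())
      (_ , Π₁ (root ()))
      (_ , Π₁ (·₁ (root ())))
      (_ , Π₁ (·₂ (root ())))
      (_ , Π₂ (root ()))
      (_ , Π₂ (·₁ (root ())))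
      (_ , Π₂ (·₂ (root ())))
  }

⇒-rule : Rule Symbol
⇒-rule = record
  { ctx        = [] ▷ η′ (con o) ▷ η′ (con o)
  ; lhs        = ε′ (var (# 1) ⇒′ var (# 0))
  ; rhs        = ε′ (var (# 1)) ⇛ ε′ (var (# 0))
  ; lhs-normal = λ where
      (_ , root ())
      (_ , ·₁ (root ()))
      (_ , ·₂ (root ()))
      (_ , ·₂ (·₁ (root ())))
      (_ , ·₂ (·₁ (·₁ (root ()))))
      (_ , ·₂ (·₁ (·₂ (root ()))))
      (_ , ·₂ (·₂ (root ())))
  ; rhs-normal = λ where
      (_ , root ())
      (_ , Π₁ (root ()))
      (_ , Π₁ (·₁ (root ())))
      (_ , Π₁ (·₂ (root ())))
      (_ , Π₂ (root ()))
      (_ , Π₂ (·₁ (root ())))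
      (_ , Π₂ (·₂ (root ())))
  }

∀-rule : Rule Symbol
∀-rule = record
  { ctx        = [] ▷ con type ▷ (η′ (var (# 0)) ⇛ η′ (con o))
  ; lhs        = ε′ (∀′ (var (# 1)) (var (# 0)))
  ; rhs        = Π (η′ (var (# 1))) (ε′ (var (# 1) · var (# 0)))
  ; lhs-normal = λ where
      (_ , root ())
      (_ , ·₁ (root ()))
      (_ , ·₂ (root ()))
      (_ , ·₂ (·₁ (root ())))
      (_ , ·₂ (·₁ (·₁ (root ()))))
      (_ , ·₂ (·₁ (·₂ (root ()))))
      (_ , ·₂ (·₂ (root ())))
  ; rhs-normal = λ where
      (_ , root ())
      (_ , Π₁ (root ()))
      (_ , Π₁ (·₁ (root ())))
      (_ , Π₁ (·₂ (root ())))
      (_ , Π₂ (root ()))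
      (_ , Π₂ (·₁ (root ())))
      (_ , Π₂ (·₂ (root ())))
      (_ , Π₂ (·₂ (·₁ (root ()))))
      (_ , Π₂ (·₂ (·₂ (root ()))))
  }

data STT-rules : Pred (Rule Symbol) 0ℓ where
  arrow-rule∈ : STT-rules arrow-rule
  ⇒-rule∈     : STT-rules ⇒-rule
  ∀-rule∈     : STT-rules ∀-rule

private
  pattern at0 = here refl
  pattern at1 = there at0
  pattern at2 = there at1
  pattern at3 = there at2
  pattern at4 = there at3
  pattern at5 = there at4
  pattern at6 = there at5
  pattern at7 = there at6

  module Derivations (𝕊 : Signature Symbol)
                     (type∈ : (type , Type) ∈ 𝕊)
                     (o∈ : (o , con type) ∈ 𝕊) where
    open Plain 𝕊

    ⊢type′ : ∀ {k} {Γ : Ctx Symbol k} → WF Γ → Γ ⊢ con type ∶ Type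
    ⊢type′ w = ⊢con w type∈

    ▷type : ∀ {k} {Γ : Ctx Symbol k} → WF Γ → WF (Γ ▷ con type)
    ▷type w = declare ⋆ (⊢type′ w)

    ⊢type⇛Type : ∀ {k} {Γ : Ctx Symbol k} → WF Γ → Γ ⊢ con type ⇛ Type ∶ Kind
    ⊢type⇛Type w = ⊢Π □ (⊢type′ w) (⊢type (▷type w))

    ⊢arrow-type : [] ⊢ con type ⇛ con type ⇛ con type ∶ Type
    ⊢arrow-type =
      ⊢Π ⋆ (⊢type′ empty)
        (⊢Π ⋆ (⊢type′ (▷type empty)) (⊢type′ (▷type (▷type empty))))

    module _ (η∈ : (η , con type ⇛ Type) ∈ 𝕊) where

      ⊢η : ∀ {k} {Γ : Ctx Symbol k} {t} → WF Γ → Γ ⊢ t ∶ con type →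
           Γ ⊢ η′ t ∶ Type
      ⊢η w d = ⊢· (⊢con w η∈) d

      ▷η : ∀ {k} {Γ : Ctx Symbol k} {t} → WF Γ → Γ ⊢ t ∶ con type →
           WF (Γ ▷ η′ t)
      ▷η w d = declare ⋆ (⊢η w d)

      ⊢ηo : ∀ {k} {Γ : Ctx Symbol k} → WF Γ → Γ ⊢ η′ (con o) ∶ Type
      ⊢ηo w = ⊢η w (⊢con w o∈)

      ▷ηo : ∀ {k} {Γ : Ctx Symbol k} → WF Γ → WF (Γ ▷ η′ (con o))
      ▷ηo w = declare ⋆ (⊢ηo w)

      ⊢⇒-type : [] ⊢ η′ (con o) ⇛ η′ (con o) ⇛ η′ (con o) ∶ Type
      ⊢⇒-type =
        ⊢Π ⋆ (⊢ηo empty) (⊢Π ⋆ (⊢ηo (▷ηo empty)) (⊢ηo (▷ηo (▷ηo empty))))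

      ⊢ε-type : [] ⊢ η′ (con o) ⇛ Type ∶ Kind
      ⊢ε-type = ⊢Π □ (⊢ηo empty) (⊢type (▷ηo empty))

      ⊢pred : ∀ {k} {Γ : Ctx Symbol k} {t} → WF Γ → Γ ⊢ t ∶ con type →
              Γ ⊢ η′ t ⇛ η′ (con o) ∶ Type
      ⊢pred w d = ⊢Π ⋆ (⊢η w d) (⊢ηo (▷η w d))

      ⊢∀-type : [] ⊢ Π (con type) ((η′ (var (# 0)) ⇛ η′ (con o)) ⇛ η′ (con o))
                ∶ Type
      ⊢∀-type = ⊢Π ⋆ (⊢type′ empty) (⊢Π ⋆ p (⊢ηo (declare ⋆ p)))
        where
        p : [] ▷ con type ⊢ η′ (var (# 0)) ⇛ η′ (con o) ∶ Type
        p = ⊢pred (▷type empty) (⊢var (▷type empty) (# 0))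

  STT-signature-wf : WFSignature STT-signature
  STT-signature-wf =
    add □ (add ⋆ (add ⋆ (add □ (add ⋆ (add ⋆ (add ⋆ (add □ []
      (Plain.⊢type Plain.empty) [])
      (Plain.⊢con Plain.empty at0) ((λ ()) ∷ []))
      (Plain.⊢con Plain.empty at1) ((λ ()) ∷ (λ ()) ∷ []))
      (Derivations.⊢arrow-type _ at2 at0)
      ((λ ()) ∷ (λ ()) ∷ (λ ()) ∷ []))
      (Derivations.⊢type⇛Type _ at3 at1 Plain.empty)
      ((λ ()) ∷ (λ ()) ∷ (λ ()) ∷ (λ ()) ∷ []))
      (Derivations.⊢⇒-type _ at4 at2 at0)
      ((λ ()) ∷ (λ ()) ∷ (λ ()) ∷ (λ ()) ∷ (λ ()) ∷ []))
      (Derivations.⊢∀-type _ at5 at3 at1)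
      ((λ ()) ∷ (λ ()) ∷ (λ ()) ∷ (λ ()) ∷ (λ ()) ∷ (λ ()) ∷ []))
      (Derivations.⊢ε-type _ at6 at4 at2)
      ((λ ()) ∷ (λ ()) ∷ (λ ()) ∷ (λ ()) ∷ (λ ()) ∷ (λ ()) ∷ (λ ()) ∷ [])

  open Plain STT-signature
  open Derivations STT-signature at7 at5

  ⊢ε : ∀ {k} {Γ : Ctx Symbol k} {t} → WF Γ → Γ ⊢ t ∶ η′ (con o) →
       Γ ⊢ ε′ t ∶ Type
  ⊢ε w d = ⊢· (⊢con w at0) d

  STT-well-typed : ∀ {ϱ} → STT-rules ϱ → WellTyped STT-signature ϱ
  STT-well-typed arrow-rule∈ = record
    { ctx-wf      = w
    ; common-type = Type
        , ⊢η at3 w (⊢· (⊢· (⊢con w at4) x) y)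
        , ⊢Π ⋆ (⊢η at3 w x) (⊢η at3 w′ (⊢var w′ (# 1)))
    }
    where
    w  = ▷type (▷type empty)
    x  = ⊢var w (# 1)
    y  = ⊢var w (# 0)
    w′ = ▷η at3 w x
  STT-well-typed ⇒-rule∈ = record
    { ctx-wf      = w
    ; common-type = Type
        , ⊢ε w (⊢· (⊢· (⊢con w at2) x) y)
        , ⊢Π ⋆ (⊢ε w x) (⊢ε w′ (⊢var w′ (# 1)))
    }
    where
    w  = ▷ηo at3 (▷ηo at3 empty)
    x  = ⊢var w (# 1)
    y  = ⊢var w (# 0)
    w′ = declare ⋆ (⊢ε w x)
  STT-well-typed ∀-rule∈ = record
    { ctx-wf      = w
    ; common-type = Type
        , ⊢ε w (⊢· (⊢· (⊢con w at1) x) y)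
        , ⊢Π ⋆ (⊢η at3 w x) (⊢ε w′ (⊢· (⊢var w′ (# 1)) (⊢var w′ (# 0))))
    }
    where
    w₀ = ▷type empty
    w  = declare ⋆ (⊢pred at3 w₀ (⊢var w₀ (# 0)))
    x  = ⊢var w (# 1)
    y  = ⊢var w (# 0)
    w′ = ▷η at3 w x

STT : Theory
STT = record
  { Const      = Symbol
  ; 𝕊          = STT-signature
  ; R          = STT-rules
  ; 𝕊-wf       = STT-signature-wf
  ; well-typed = STT-well-typed
  }

{-# OPTIONS --safe #-}

-- The model has four levels.  The first only tells kinds from types: the value
-- of a type is {∅}, so that objects have the value ∅ at the second level, where
-- abstractions and applications can therefore forget their arguments.  The
-- third level interprets the objects of type `type` by sets built from a copy
-- of the carrier, and η by the identity; there the objects of type η a and ε p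
-- have the value ∅.  The fourth level is the truth-value interpretation.
-- Functions are encoded by Aczel's traces, which identify the constant function
-- ∅ with ∅: hence the products of {∅} are {∅}, as the rewrite rules require.
--
-- A β-step preserves values because the value of the argument belongs to the
-- domain of the abstraction; by the membership condition this only involves the
-- values of types one level below.  So membership and invariance under
-- conversion are proved alternately, level by level; confluence and subject
-- reduction restrict the latter to reductions of typed terms.

module Submission where

open import Defs
open import Data.Bool.Base using (Bool; true; false)
open import Data.Empty using (⊥; ⊥-elim)
open import Data.Fin.Base using (Fin; zero; suc)
open import Data.List.Membership.Propositional using (_∈_)
open import Data.List.Relation.Unary.Any using (here; there)
open import Data.Maybe.Base using (Maybe; just; nothing; fromMaybe)
open import Data.Nat.Base using (ℕ; suc; _<_; s≤s)
open import Data.Product.Base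
  using (Σ-syntax; ∃-syntax; _×_; _,_; proj₁; proj₂)
open import Data.Sum.Base using (_⊎_; inj₁; inj₂)
open import Data.Unit.Base using (⊤; tt)
open import Data.Vec.Base using ([]; _∷_)
open import Data.Vec.Functional using (Vector) renaming (_∷_ to _◂_)
open import Data.Vec.Relation.Binary.Pointwise.Inductive
  using (Pointwise; []; _∷_)
open import Function.Base using (_∘_)
open import Function.Bundles using (_⇔_; mk⇔; Equivalence)
open import Relation.Binary.Construct.Closure.Equivalence using (symmetric)
open import Relation.Binary.Construct.Closure.Equivalence.Properties
  using (a—↠b⇒a↔b; a—↠b⇒b↔a)
open import Relation.Binary.Construct.Closure.ReflexiveTransitive
  using (Star; _◅_; _◅◅_; return) renaming (ε to nil)
open import Relation.Binary.Construct.Closure.Symmetric using (fwd; bwd)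
open import Relation.Binary.PropositionalEquality.Core
  using (_≡_; _≢_; refl; sym; trans; cong; cong₂)
open import Relation.Binary.Structures using (IsPreorder)

-- Iterative sets

-- _≈_ and _∈ᵛ_ unfold on constructor forms, so that their arguments cannot
-- be inferred; these wrappers are injective.
infix 4 _≋_ _ϵ_

record _≋_ (S T : 𝕍) : Set where
  constructor wrap
  field unwrap : S ≈ T
open _≋_

record _ϵ_ (v S : 𝕍) : Set where
  constructor at
  field
    ix : index S
    eq : v ≋ elt S ix
open _ϵ_

≈-refl : ∀ S → S ≈ S
≈-refl (sup I f) = (λ i → i , ≈-refl (f i)) , (λ i → i , ≈-refl (f i))

≈-sym : ∀ S T → S ≈ T → T ≈ S
≈-sym (sup I f) (sup J g) (p , q) =
  (λ j → let i , e = q j in i , ≈-sym (f i) (g j) e) ,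
  (λ i → let j , e = p i in j , ≈-sym (f i) (g j) e)

≈-trans : ∀ S T U → S ≈ T → T ≈ U → S ≈ U
≈-trans (sup I f) (sup J g) (sup K h) (p , q) (p′ , q′) =
  (λ i → let j , e = p i ; k , e′ = p′ j in
         k , ≈-trans (f i) (g j) (h k) e e′) ,
  (λ k → let j , e′ = q′ k ; i , e = q j in
         i , ≈-trans (f i) (g j) (h k) e e′)

≋-refl : ∀ {S} → S ≋ S
≋-refl {S} = wrap (≈-refl S)

≋-sym : ∀ {S T} → S ≋ T → T ≋ S
≋-sym (wrap e) = wrap (≈-sym _ _ e)

≋-trans : ∀ {S T U} → S ≋ T → T ≋ U → S ≋ U
≋-trans {S} {T} {U} (wrap e) (wrap e′) = wrap (≈-trans S T U e e′)

elt∈ : ∀ {S} i → elt S i ϵ S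
elt∈ i = at i ≋-refl

∈-respˡ : ∀ {v w S} → v ≋ w → w ϵ S → v ϵ S
∈-respˡ e (at i e′) = at i (≋-trans e e′)

∈-respʳ : ∀ {v S T} → S ≋ T → v ϵ S → v ϵ T
∈-respʳ {S = sup _ _} {sup _ _} (wrap (p , _)) (at i e) =
  let j , e′ = p i in at j (≋-trans e (wrap e′))

∈ᵛ⇒ϵ : ∀ {v S} → v ∈ᵛ S → v ϵ S
∈ᵛ⇒ϵ (i , e) = at i (wrap e)

ϵ⇒∈ᵛ : ∀ {v S} → v ϵ S → v ∈ᵛ S
ϵ⇒∈ᵛ (at i (wrap e)) = i , e

≋-ext : ∀ {S T} → (∀ i → elt S i ϵ T) → (∀ j → elt T j ϵ S) → S ≋ T
≋-ext {sup _ _} {sup _ _} p q =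
  wrap ((λ i → ϵ⇒∈ᵛ (p i)) ,
        (λ j → let at i e = q j in i , unwrap (≋-sym e)))

∈-ext : ∀ {S T} → (∀ {v} → v ϵ S → v ϵ T) → (∀ {v} → v ϵ T → v ϵ S) → S ≋ T
∈-ext p q = ≋-ext (λ i → p (elt∈ i)) (λ j → q (elt∈ j))

sup-cong : ∀ {I} {f g : I → 𝕍} → (∀ i → f i ≋ g i) → sup I f ≋ sup I g
sup-cong e = ≋-ext (λ i → at i (e i)) (λ i → at i (≋-sym (e i)))

∅ : 𝕍
∅ = sup ⊥ ⊥-elim

sing : 𝕍 → 𝕍
sing v = sup ⊤ (λ _ → v)

One : 𝕍
One = sing ∅

∈∅ : ∀ {a} {A : Set a} {v} → v ϵ ∅ → A
∈∅ (at () _)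

∅-unique : ∀ {S} → (∀ {v} → v ϵ S → v ϵ ∅) → S ≋ ∅
∅-unique p = ∈-ext p ∈∅

sing-cong : ∀ {v w} → v ≋ w → sing v ≋ sing w
sing-cong e = sup-cong (λ _ → e)

sing-injective : ∀ {v w} → sing v ≋ sing w → v ≋ w
sing-injective e = eq (∈-respʳ e (elt∈ tt))

∅≢sing : ∀ {a} {A : Set a} {v} → ∅ ≋ sing v → A
∅≢sing e = ∈∅ (∈-respʳ (≋-sym e) (elt∈ tt))

∈One : ∀ {v S} → v ϵ S → S ≋ One → v ≋ ∅
∈One p e = eq (∈-respʳ e p)

∅∈One : ∅ ϵ One
∅∈One = elt∈ tt

-- Kuratowski pairs

duo : 𝕍 → 𝕍 → 𝕍
duo a b = sup Bool λ where
  false → a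
  true  → b

opaque
  pair : 𝕍 → 𝕍 → 𝕍
  pair a b = duo (sing a) (duo a b)

private
  ∈sing : ∀ {v a} → v ϵ sing a → v ≋ a
  ∈sing = eq

  ∈duo : ∀ {v a b} → v ϵ duo a b → v ≋ a ⊎ v ≋ b
  ∈duo (at false e) = inj₁ e
  ∈duo (at true  e) = inj₂ e

  duo-cong : ∀ {a a′ b b′} → a ≋ a′ → b ≋ b′ → duo a b ≋ duo a′ b′
  duo-cong e e′ = sup-cong λ where
    false → e
    true  → e′

  fst∈ : ∀ {a b} → a ϵ duo a b
  fst∈ = elt∈ false

  snd∈ : ∀ {a b} → b ϵ duo a b
  snd∈ = elt∈ true

opaque
  unfolding pair

  pair-cong : ∀ {a a′ b b′} → a ≋ a′ → b ≋ b′ → pair a b ≋ pair a′ b′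
  pair-cong e e′ = duo-cong (sing-cong e) (duo-cong e e′)

  pair-injectiveˡ : ∀ {a b c d} → pair a b ≋ pair c d → a ≋ c
  pair-injectiveˡ {a} {b} {c} {d} e with ∈duo (∈-respʳ e fst∈)
  ... | inj₁ e₁ = sing-injective e₁
  ... | inj₂ e₁ = ≋-sym (∈sing (∈-respʳ (≋-sym e₁) fst∈))

  -- Equality of sets is not decidable, but a member of a `duo` comes with the component it equals.
  -- Locating `duo a b` and `duo c d` each in the other pair therefore yields finitely many cases.
  pair-injectiveʳ : ∀ {a b c d} → pair a b ≋ pair c d → b ≋ d
  pair-injectiveʳ {a} {b} {c} {d} e with ∈duo (∈-respʳ e snd∈)
                                       | ∈duo (∈-respʳ (≋-sym e) snd∈)
  ... | inj₂ ab | _ with ∈duo (∈-respʳ ab snd∈) | ∈duo (∈-respʳ (≋-sym ab) snd∈)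
  ...   | inj₂ bd | _ = bd
  ...   | inj₁ bc | inj₂ db = ≋-sym db
  ...   | inj₁ bc | inj₁ da =
    ≋-trans bc (≋-trans (≋-sym (pair-injectiveˡ e)) (≋-sym da))
  pair-injectiveʳ {a} {b} {c} {d} e | inj₁ ab | inj₁ cd =
    ≋-trans (∈sing (∈-respʳ ab snd∈))
      (≋-trans (≋-sym (pair-injectiveˡ e)) (≋-sym (∈sing (∈-respʳ cd snd∈))))
  pair-injectiveʳ {a} {b} {c} {d} e | inj₁ ab | inj₂ cd
    with ∈duo (∈-respʳ cd snd∈)
  ... | inj₂ db = ≋-sym db
  ... | inj₁ da = ≋-trans (∈sing (∈-respʳ ab snd∈))
      (≋-trans (≋-sym (pair-injectiveˡ e)) (≋-sym da))

  -- y is reached from ⟨ x , y ⟩ ∈ f through two unions.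
  app : 𝕍 → 𝕍 → 𝕍
  app f x =
    sup (Σ[ i ∈ index f ] Σ[ j ∈ index (elt f i) ]
         Σ[ k ∈ index (elt (elt f i) j) ]
           pair x (elt (elt (elt f i) j) k) ϵ f)
        (λ (i , j , k , _) → elt (elt (elt f i) j) k)

  ∈app⁺ : ∀ {f x y} → pair x y ϵ f → y ϵ app f x
  ∈app⁺ {f} {x} {y} p@(at i e) =
    let at j e₁ = ∈-respʳ e snd∈
        at k e₂ = ∈-respʳ e₁ (snd∈ {x} {y})
    in at (i , j , k , ∈-respˡ (pair-cong ≋-refl (≋-sym e₂)) p) e₂

  ∈app⁻ : ∀ {f x y} → y ϵ app f x → pair x y ϵ f
  ∈app⁻ (at (_ , _ , _ , p) e) = ∈-respˡ (pair-cong ≋-refl e) p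

  -- Aczel's encoding of functions: the graph pairs x with the elements of
  -- the value at x, so that the constant function ∅ is ∅ on any domain.
  lam : (D : 𝕍) → (index D → 𝕍) → 𝕍
  lam D F = sup (Σ[ i ∈ index D ] index (F i))
                (λ (i , j) → pair (elt D i) (elt (F i) j))

-- Functions on a set are given on its indices, several of which may denote the same element.
Respects : (D : 𝕍) → (index D → 𝕍) → Set
Respects D F = ∀ i j → elt D i ≋ elt D j → F i ≋ F j

app-cong : ∀ {f f′ x x′} → f ≋ f′ → x ≋ x′ → app f x ≋ app f′ x′
app-cong e e′ = ∈-ext
  (λ p → ∈app⁺ (∈-respˡ (pair-cong (≋-sym e′) ≋-refl) (∈-respʳ e (∈app⁻ p))))
  (λ p → ∈app⁺ (∈-respˡ (pair-cong e′ ≋-refl) (∈-respʳ (≋-sym e) (∈app⁻ p))))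

app-∅ : ∀ {f x} → f ≋ ∅ → app f x ≋ ∅
app-∅ e = ∅-unique (λ p → ∈∅ (∈-respʳ e (∈app⁻ p)))

app-respects : ∀ D {f} → Respects D (λ i → app f (elt D i))
app-respects D i j e = app-cong ≋-refl e

opaque
  unfolding lam

  lam-cong : ∀ {D D′} {F : index D → 𝕍} {F′ : index D′ → 𝕍} → D ≋ D′ →
             (∀ i j → elt D i ≋ elt D′ j → F i ≋ F′ j) → lam D F ≋ lam D′ F′
  lam-cong {D} {D′} e e′ = ≋-ext
    (λ (i , k) → let at j p = ∈-respʳ e (elt∈ i)
                     at l q = ∈-respʳ (e′ i j p) (elt∈ k)
                 in at (j , l) (pair-cong p q))
    (λ (j , l) → let at i p = ∈-respʳ (≋-sym e) (elt∈ j)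
                     at k q = ∈-respʳ (≋-sym (e′ i j (≋-sym p))) (elt∈ l)
                 in at (i , k) (pair-cong p q))

  lam-∅ : ∀ {D F} → (∀ i → F i ≋ ∅) → lam D F ≋ ∅
  lam-∅ e = ∅-unique (λ where
    (at (i , j) _) → ∈∅ (∈-respʳ (e i) (elt∈ j)))

  -- The elements of the left side may come from any index denoting `x`; `Respects` moves them to
  -- `F i`.
  app-lam : ∀ {D F x} i → Respects D F → x ≋ elt D i → app (lam D F) x ≋ F i
  app-lam {D} {F} {x} i r e = ∈-ext
    (λ p → let at (j , k) q = ∈app⁻ p in
           ∈-respʳ (r j i (≋-trans (≋-sym (pair-injectiveˡ q)) e))
                   (at k (pair-injectiveʳ q)))
    (λ (at k q) → ∈app⁺ (at (i , k) (pair-cong e q)))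

-- Dependent products

opaque
  -- Choosing indices `g` instead of elements keeps the index type of the product small; `Respects`
  -- discards the choices that depend on how an argument is named.
  Pi : (D : 𝕍) → (index D → 𝕍) → 𝕍
  Pi D E = sup (Σ[ g ∈ (∀ i → index (E i)) ] Respects D (λ i → elt (E i) (g i)))
               (λ (g , _) → lam D (λ i → elt (E i) (g i)))

  Pi-app : ∀ {D E f} → f ϵ Pi D E → ∀ i → app f (elt D i) ϵ E i
  Pi-app (at (g , r) e) i =
    at (g i) (≋-trans (app-cong e ≋-refl) (app-lam i r ≋-refl))

  Pi-η : ∀ {D E f} → f ϵ Pi D E → f ≋ lam D (λ i → app f (elt D i))
  Pi-η {D} (at (g , r) e) = ≋-trans e
    (lam-cong {D} {D} ≋-refl λ i j p → ≋-sym
      (≋-trans (app-cong e (≋-sym p)) (app-lam i r ≋-refl)))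

  Pi-lam : ∀ {D E F} → Respects D F → (∀ i → F i ϵ E i) → lam D F ϵ Pi D E
  Pi-lam {D} r p =
    at ((λ i → ix (p i)) ,
        (λ i j e → ≋-trans (≋-sym (eq (p i))) (≋-trans (r i j e) (eq (p j)))))
       (lam-cong {D} {D} ≋-refl λ i j e → ≋-trans (r i j e) (eq (p j)))

-- Converse of `Pi-app` and `Pi-η` together: membership means being a trace whose values lie in the
-- fibres.
Pi-intro : ∀ {D E f} → f ≋ lam D (λ i → app f (elt D i)) →
           (∀ i → app f (elt D i) ϵ E i) → f ϵ Pi D E
Pi-intro {D} e p = ∈-respˡ e (Pi-lam (app-respects D) p)

private
  Pi-⊆ : ∀ {D D′ E E′ f} → D ≋ D′ →
         (∀ i j → elt D i ≋ elt D′ j → E i ≋ E′ j) → f ϵ Pi D E → f ϵ Pi D′ E′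
  Pi-⊆ {D} {D′} e e′ p = Pi-intro
    (≋-trans (Pi-η p) (lam-cong e λ i j q → app-cong ≋-refl q))
    (λ j → let at i q = ∈-respʳ (≋-sym e) (elt∈ j) in
           ∈-respˡ (app-cong ≋-refl q)
                   (∈-respʳ (e′ i j (≋-sym q)) (Pi-app p i)))

Pi-cong : ∀ {D D′} {E : index D → 𝕍} {E′ : index D′ → 𝕍} → D ≋ D′ →
          (∀ i j → elt D i ≋ elt D′ j → E i ≋ E′ j) → Pi D E ≋ Pi D′ E′
Pi-cong e e′ = ∈-ext (Pi-⊆ e e′)
  (Pi-⊆ (≋-sym e) λ j i q → ≋-sym (e′ i j (≋-sym q)))

-- The trace of the constant function ∅ is ∅.
∅∈Pi : ∀ {D E} → (∀ i → ∅ ϵ E i) → ∅ ϵ Pi D E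
∅∈Pi p = Pi-intro (≋-sym (lam-∅ λ _ → app-∅ ≋-refl))
                  (λ i → ∈-respˡ (app-∅ ≋-refl) (p i))

Pi-One : ∀ {D E} → (∀ i → E i ≋ One) → Pi D E ≋ One
Pi-One e = ∈-ext
  (λ p → at tt (≋-trans (Pi-η p) (lam-∅ λ i → ∈One (Pi-app p i) (e i))))
  (λ p → ∈-respˡ (eq p) (∅∈Pi λ i → ∈-respʳ (≋-sym (e i)) ∅∈One))

Pi-app′ : ∀ {D E f x} → f ϵ Pi D E → (p : x ϵ D) → app f x ϵ E (ix p)
Pi-app′ q p = ∈-respˡ (app-cong ≋-refl (eq p)) (Pi-app q (ix p))

-- Functions of two arguments

app₂ : 𝕍 → 𝕍 → 𝕍 → 𝕍
app₂ f x y = app (app f x) y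

lam₂ : (D S : 𝕍) → (index D → index S → 𝕍) → 𝕍
lam₂ D S F = lam D λ i → lam S λ j → F i j

-- At the fourth level a function takes two values of its argument, one in `D₁ A` and one in `D₂ A`.
-- The fibre depends on the first alone, because the third-level value of a codomain ignores the
-- fourth-level values of its variables.
Pi₂ : (D S : 𝕍) → (index D → 𝕍) → 𝕍
Pi₂ D S E = Pi D λ i → Pi S λ _ → E i

Respects₂ : (D S : 𝕍) → (index D → index S → 𝕍) → Set
Respects₂ D S F = ∀ i i′ j j′ → elt D i ≋ elt D i′ → elt S j ≋ elt S j′ →
                  F i j ≋ F i′ j′

app₂-cong : ∀ {f f′ x x′ y y′} → f ≋ f′ → x ≋ x′ → y ≋ y′ →
            app₂ f x y ≋ app₂ f′ x′ y′
app₂-cong e e′ e″ = app-cong (app-cong e e′) e″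

lam₂-cong : ∀ {D D′ S S′} {F : index D → index S → 𝕍}
            {F′ : index D′ → index S′ → 𝕍} → D ≋ D′ → S ≋ S′ →
            (∀ i i′ j j′ → elt D i ≋ elt D′ i′ → elt S j ≋ elt S′ j′ →
             F i j ≋ F′ i′ j′) →
            lam₂ D S F ≋ lam₂ D′ S′ F′
lam₂-cong e e′ e″ = lam-cong e λ i i′ p → lam-cong e′ λ j j′ → e″ i i′ j j′ p

Pi₂-cong : ∀ {D D′ S S′} {E : index D → 𝕍} {E′ : index D′ → 𝕍} →
           D ≋ D′ → S ≋ S′ → (∀ i i′ → elt D i ≋ elt D′ i′ → E i ≋ E′ i′) →
           Pi₂ D S E ≋ Pi₂ D′ S′ E′
Pi₂-cong e e′ e″ = Pi-cong e λ i i′ p → Pi-cong e′ λ _ _ _ → e″ i i′ p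

app₂-lam₂ : ∀ {D S F x y} i j → Respects₂ D S F → x ≋ elt D i → y ≋ elt S j →
            app₂ (lam₂ D S F) x y ≋ F i j
app₂-lam₂ {D} {S} i j r e e′ = ≋-trans
  (app-cong (app-lam i (λ i i′ p → lam-cong {S} {S} ≋-refl λ j j′ → r i i′ j j′ p) e)
            ≋-refl)
  (app-lam j (λ j j′ → r i i j j′ ≋-refl) e′)

lam₂∈Pi₂ : ∀ {D S F E} → Respects₂ D S F → (∀ i j → F i j ϵ E i) →
           lam₂ D S F ϵ Pi₂ D S E
lam₂∈Pi₂ {D} {S} r p = Pi-lam
  (λ i i′ q → lam-cong {S} {S} ≋-refl λ j j′ → r i i′ j j′ q)
  (λ i → Pi-lam (λ j j′ → r i i j j′ ≋-refl) (p i))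

app₂∈ : ∀ {D S E f x y} → f ϵ Pi₂ D S E → (p : x ϵ D) → y ϵ S →
        app₂ f x y ϵ E (ix p)
app₂∈ q p p′ = Pi-app′ (Pi-app′ q p) p′

Pi₂-intro : ∀ {D S E E′ f} → f ϵ Pi₂ D S E →
            (∀ i j → app₂ f (elt D i) (elt S j) ϵ E′ i) → f ϵ Pi₂ D S E′
Pi₂-intro q p = Pi-intro (Pi-η q) (λ i → Pi-intro (Pi-η (Pi-app q i)) (p i))

≡⇒≋ : ∀ {S T : 𝕍} → S ≡ T → S ≋ T
≡⇒≋ refl = ≋-refl

-- Typed terms

open Typing STT-signature STT-rules

Tm : ℕ → Set
Tm = Term Symbol

infix 4 _⟶_ _—↠_ _↔_
_⟶_ _—↠_ _↔_ : TermRel Symbol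
_⟶_  = βR-step STT-rules
_—↠_ = Star _⟶_
_↔_  = βR-conv STT-rules

data Object {k} : Tm k → Set where
  var : ∀ x → Object (var x)
  con : ∀ c → Object (con c)
  Π   : ∀ {A B} → Object A → Object B → Object (Π A B)
  ƛ   : ∀ {A t} → Object A → Object t → Object (ƛ A t)
  _·_ : ∀ {t u} → Object t → Object u → Object (t · u)

data IsKind {k} : Tm k → Set where
  type : IsKind Type
  Π    : ∀ {A B} → Object A → IsKind B → IsKind (Π A B)

IsType : ∀ {k} → Tm k → Set
IsType A = Object A ⊎ IsKind A

Object-rename : ∀ {k l t} {ρ : Fin k → Fin l} → Object t → Object (rename ρ t)
Object-rename (var x) = var _
Object-rename (con c) = con c
Object-rename (Π p q) = Π (Object-rename p) (Object-rename q)
Object-rename (ƛ p q) = ƛ (Object-rename p) (Object-rename q)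
Object-rename (p · q) = Object-rename p · Object-rename q

IsKind-rename : ∀ {k l t} {ρ : Fin k → Fin l} → IsKind t → IsKind (rename ρ t)
IsKind-rename type    = type
IsKind-rename (Π p q) = Π (Object-rename p) (IsKind-rename q)

IsType-rename : ∀ {k l t} {ρ : Fin k → Fin l} → IsType t → IsType (rename ρ t)
IsType-rename (inj₁ p) = inj₁ (Object-rename p)
IsType-rename (inj₂ p) = inj₂ (IsKind-rename p)

Objects : ∀ {k l} → (Fin k → Tm l) → Set
Objects θ = ∀ x → Object (θ x)

Objects-lifts : ∀ {k l} {θ : Fin k → Tm l} → Objects θ → Objects (lifts θ)
Objects-lifts h zero    = var zero
Objects-lifts h (suc x) = Object-rename (h x)

Object-subst : ∀ {k l t} {θ : Fin k → Tm l} → Objects θ → Object t →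
               Object (subst θ t)
Object-subst h (var x) = h x
Object-subst h (con c) = con c
Object-subst h (Π p q) = Π (Object-subst h p) (Object-subst (Objects-lifts h) q)
Object-subst h (ƛ p q) = ƛ (Object-subst h p) (Object-subst (Objects-lifts h) q)
Object-subst h (p · q) = Object-subst h p · Object-subst h q

IsKind-subst : ∀ {k l t} {θ : Fin k → Tm l} → Objects θ → IsKind t →
               IsKind (subst θ t)
IsKind-subst h type    = type
IsKind-subst h (Π p q) = Π (Object-subst h p) (IsKind-subst (Objects-lifts h) q)

IsType-subst : ∀ {k l t} {θ : Fin k → Tm l} → Objects θ → IsType t →
               IsType (subst θ t)
IsType-subst h (inj₁ p) = inj₁ (Object-subst h p)
IsType-subst h (inj₂ p) = inj₂ (IsKind-subst h p)

Objects-[] : ∀ {k} {u : Tm k} → Object u → Objects (u ◂ var)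
Objects-[] p zero    = p
Objects-[] p (suc x) = var x

IsType-dom : ∀ {k A} {B : Tm (suc k)} → IsType (Π A B) → Object A
IsType-dom (inj₁ (Π p _)) = p
IsType-dom (inj₂ (Π p _)) = p

IsType-cod : ∀ {k A} {B : Tm (suc k)} → IsType (Π A B) → IsType B
IsType-cod (inj₁ (Π _ q)) = inj₁ q
IsType-cod (inj₂ (Π _ q)) = inj₂ q

-- The signature and the classification of typed terms

typeOf : Symbol → Tm 0
typeOf type  = Type
typeOf ι     = con type
typeOf o     = con type
typeOf arrow = con type ⇛ con type ⇛ con type
typeOf η     = con type ⇛ Type
typeOf ⇒̇     = η′ (con o) ⇛ η′ (con o) ⇛ η′ (con o)
typeOf ∀̇     = Π (con type) ((η′ (var zero) ⇛ η′ (con o)) ⇛ η′ (con o))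
typeOf ε     = η′ (con o) ⇛ Type

∈⇒typeOf : ∀ {c A} → (c , A) ∈ STT-signature → A ≡ typeOf c
∈⇒typeOf (here refl) = refl
∈⇒typeOf (there (here refl)) = refl
∈⇒typeOf (there (there (here refl))) = refl
∈⇒typeOf (there (there (there (here refl)))) = refl
∈⇒typeOf (there (there (there (there (here refl))))) = refl
∈⇒typeOf (there (there (there (there (there (here refl)))))) = refl
∈⇒typeOf (there (there (there (there (there (there (here refl))))))) = refl
∈⇒typeOf (there (there (there (there (there (there (there (here refl)))))))) =
  refl

IsType-typeOf : ∀ c → IsType (typeOf c)
IsType-typeOf type  = inj₂ type
IsType-typeOf ι     = inj₁ (con _)
IsType-typeOf o     = inj₁ (con _)
IsType-typeOf arrow = inj₁ (Π (con _) (Π (con _) (con _)))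
IsType-typeOf η     = inj₂ (Π (con _) type)
IsType-typeOf ⇒̇     =
  inj₁ (Π (con _ · con _) (Π (con _ · con _) (con _ · con _)))
IsType-typeOf ∀̇     = inj₁ (Π (con _)
  (Π (Π (con _ · var _) (con _ · con _)) (con _ · con _)))
IsType-typeOf ε     = inj₂ (Π (con _ · con _) type)

-- Every domain of a product or abstraction has type `Type`, and `Kind` has no type; hence a sort
-- occurs in a typed term only as the final codomain of a kind.
data Classified {k} (t A : Tm k) : Set where
  object : Object t → IsType A → Classified t A
  kind   : IsKind t → A ≡ Kind → Classified t A

wf : ∀ {k} {Γ : Ctx Symbol k} {t A} → Γ ⊢ t ∶ A → WF Γ
wf (⊢type w)         = w
wf (⊢var w x)        = w
wf (⊢con w m)        = w
wf (⊢Π s d e)        = wf d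
wf (⊢ƛ s d e f)      = wf d
wf (⊢· d e)          = wf d
wf (⊢conv s d e f _) = wf d

Types-in : ∀ {k} → Ctx Symbol k → Set
Types-in Γ = ∀ x → IsType (lookup Γ x)

Types-in-▷ : ∀ {k} {Γ : Ctx Symbol k} {A} → Types-in Γ → IsType A →
             Types-in (Γ ▷ A)
Types-in-▷ h p zero    = IsType-rename p
Types-in-▷ h p (suc x) = IsType-rename (h x)

private
  -- Assuming `Types-in Γ`, rather than extracting it from the derivation, keeps the induction
  -- structural; `lookup-IsType` supplies it by induction on the context.
  classify′ : ∀ {k} {Γ : Ctx Symbol k} {t A} → Types-in Γ → Γ ⊢ t ∶ A →
              Classified t A
  classify′ h (⊢type w)  = kind type refl
  classify′ h (⊢var w x) = object (var x) (h x)
  classify′ h (⊢con {c} w m) with refl ← ∈⇒typeOf m =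
    object (con c) (IsType-rename (IsType-typeOf c))
  classify′ h (⊢Π s d e) with classify′ h d
  ... | object p _ with classify′ (Types-in-▷ h (inj₁ p)) e
  ...   | kind q refl          = kind (Π p q) refl
  ...   | object q (inj₂ type) = object (Π p q) (inj₂ type)
  classify′ h (⊢ƛ s d e f) with classify′ h d
  ... | object p _ with classify′ (Types-in-▷ h (inj₁ p)) e
                      | classify′ (Types-in-▷ h (inj₁ p)) f
  ...   | object q _  | object r _ = object (ƛ p r) (inj₁ (Π p q))
  ...   | kind q _    | object r _ = object (ƛ p r) (inj₂ (Π p q))
  ...   | object () _ | kind _ refl
  ...   | kind () _   | kind _ refl
  classify′ h (⊢· d e) with classify′ h d | classify′ h e
  ... | object p i | object q _ =
    object (p · q) (IsType-subst (Objects-[] q) (IsType-cod i))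
  ... | object p i | kind _ refl with () ← IsType-dom i
  classify′ h (⊢conv s d e f _)
    with classify′ h f | classify′ h d | classify′ h e
  ... | object p _  | _           | object q _ = object p (inj₁ q)
  ... | object p _  | _           | kind q _   = object p (inj₂ q)
  ... | kind _ refl | object () _ | _
  ... | kind _ refl | kind () _   | _

lookup-IsType : ∀ {k} {Γ : Ctx Symbol k} → WF Γ → Types-in Γ
lookup-IsType {Γ = Γ ▷ A} (declare s d) with lookup-IsType (wf d)
... | h with classify′ h d
...   | object p _ = Types-in-▷ h (inj₁ p)
...   | kind p _   = Types-in-▷ h (inj₂ p)

classify : ∀ {k} {Γ : Ctx Symbol k} {t A} → Γ ⊢ t ∶ A → Classified t A
classify d = classify′ (lookup-IsType (wf d)) d

type-Object : ∀ {k} {Γ : Ctx Symbol k} {A} → Γ ⊢ A ∶ Type → Object A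
type-Object d with object p _ ← classify d = p

-- Inversion of typing

infix 3 _⊢_≼_

-- Links the type found by inversion to the given one. `conv` forgets the intermediate types of a
-- chain of conversions, and `same` avoids asking the inverted type for a sort, which for variables
-- and constants would take weakening.
data _⊢_≼_ {k} (Γ : Ctx Symbol k) (A : Tm k) : Tm k → Set where
  same : Γ ⊢ A ≼ A
  conv : ∀ {B s s′} → Γ ⊢ A ∶ sort s → Γ ⊢ B ∶ sort s′ → A ↔ B → Γ ⊢ A ≼ B

module _ {k : ℕ} {Γ : Ctx Symbol k} where

  ≼-conv : ∀ {A B C s} → Γ ⊢ A ≼ B → Γ ⊢ B ∶ sort s → Γ ⊢ C ∶ sort s →
           B ↔ C → Γ ⊢ A ≼ C
  ≼-conv same         d e r = conv d e r
  ≼-conv (conv c _ q) d e r = conv c e (q ◅◅ r)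

  Π-inversion : ∀ {A B C} → Γ ⊢ Π A B ∶ C →
                Γ ⊢ A ∶ Type × ∃[ s ] Γ ▷ A ⊢ B ∶ sort s
  Π-inversion (⊢Π s d e)        = d , s , e
  Π-inversion (⊢conv s _ _ d _) = Π-inversion d

  ƛ-inversion : ∀ {A t C} → Γ ⊢ ƛ A t ∶ C →
                ∃[ B ] Γ ⊢ A ∶ Type × Γ ▷ A ⊢ t ∶ B × Γ ⊢ Π A B ≼ C
  ƛ-inversion (⊢ƛ s d e f)      = _ , d , f , same
  ƛ-inversion (⊢conv s c c′ d r) =
    let _ , e , f , g = ƛ-inversion d in _ , e , f , ≼-conv g c c′ r

  ·-inversion : ∀ {t u C} → Γ ⊢ t · u ∶ C →
                ∃[ A ] ∃[ B ] Γ ⊢ t ∶ Π A B × Γ ⊢ u ∶ A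
  ·-inversion (⊢· d e)          = _ , _ , d , e
  ·-inversion (⊢conv s _ _ d _) = ·-inversion d

  var-inversion : ∀ {x C} → Γ ⊢ var x ∶ C → Γ ⊢ lookup Γ x ≼ C
  var-inversion (⊢var w x)         = same
  var-inversion (⊢conv s c c′ d r) = ≼-conv (var-inversion d) c c′ r

  con-inversion : ∀ {c C} → Γ ⊢ con c ∶ C → Γ ⊢ close (typeOf c) ≼ C
  con-inversion (⊢con w m) with refl ← ∈⇒typeOf m = same
  con-inversion (⊢conv s c c′ d r) = ≼-conv (con-inversion d) c c′ r

-- Consequences of confluence and subject reduction

Π-irreducible : ∀ {k t u A} {B : Tm (suc k)} → RootStep STT-rules t u →
                t ≢ Π A B
Π-irreducible (instantiate arrow-rule∈ θ) ()
Π-irreducible (instantiate ⇒-rule∈ θ)     ()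
Π-irreducible (instantiate ∀-rule∈ θ)     ()

Π-step : ∀ {k A t} {B : Tm (suc k)} → Π A B ⟶ t →
         ∃[ A′ ] ∃[ B′ ] t ≡ Π A′ B′ × A —↠ A′
Π-step (root (inj₂ r)) with () ← Π-irreducible r refl
Π-step (Π₁ r) = _ , _ , refl , return r
Π-step (Π₂ r) = _ , _ , refl , nil

Π-steps : ∀ {k A t} {B : Tm (suc k)} → Π A B —↠ t →
          ∃[ A′ ] ∃[ B′ ] t ≡ Π A′ B′ × A —↠ A′
Π-steps nil = _ , _ , refl , nil
Π-steps (r ◅ rs) with _ , _ , refl , q ← Π-step r
                 with _ , _ , e , q′ ← Π-steps rs = _ , _ , e , q ◅◅ q′

module Reduction (confluent : Theory.ConfluentReduction STT)
                 (subject-reduction : Theory.SubjectReduction STT) where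

  church-rosser : ∀ {k} {t u : Tm k} → t ↔ u → ∃[ v ] t —↠ v × u —↠ v
  church-rosser nil = _ , nil , nil
  church-rosser (fwd r ◅ c) = let v , p , q = church-rosser c in v , r ◅ p , q
  church-rosser (bwd r ◅ c) =
    let _ , p , q   = church-rosser c
        v , p′ , q′ = confluent (return r) p
    in v , p′ , q ◅◅ q′

  Π-injective : ∀ {k A A′} {B B′ : Tm (suc k)} → Π A B ↔ Π A′ B′ → A ↔ A′
  Π-injective c with _ , p , q ← church-rosser c
                with _ , _ , refl , p′ ← Π-steps p
                with _ , _ , refl , q′ ← Π-steps q =
    a—↠b⇒a↔b p′ ◅◅ a—↠b⇒b↔a q′

  -- Injectivity of products up to conversion. It gives the argument of a β-redex the type annotated
  -- on the abstraction, and the argument of a constant the declared type.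
  ⊢dom : ∀ {k} {Γ : Ctx Symbol k} {A A′ B B′ u} → Γ ⊢ Π A B ≼ Π A′ B′ →
         Γ ⊢ u ∶ A′ → Γ ⊢ u ∶ A
  ⊢dom same         d = d
  ⊢dom (conv p q c) d =
    ⊢conv ⋆ (proj₁ (Π-inversion q)) (proj₁ (Π-inversion p)) d
          (symmetric _ (Π-injective c))

  ⊢con-arg : ∀ {k} {Γ : Ctx Symbol k} {c A B u C} → close (typeOf c) ≡ Π A B →
             Γ ⊢ con c · u ∶ C → Γ ⊢ u ∶ A
  ⊢con-arg e d with _ , _ , f , d′ ← ·-inversion d with con-inversion f
  ... | g rewrite e = ⊢dom g d′

  ⊢η-arg : ∀ {k} {Γ : Ctx Symbol k} {t C} → Γ ⊢ η′ t ∶ C → Γ ⊢ t ∶ con type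
  ⊢η-arg = ⊢con-arg refl

  ⊢ε-arg : ∀ {k} {Γ : Ctx Symbol k} {t C} → Γ ⊢ ε′ t ∶ C → Γ ⊢ t ∶ η′ (con o)
  ⊢ε-arg = ⊢con-arg refl

  module _ {k : ℕ} {Γ : Ctx Symbol k} (f : Tm k → 𝕍)
           (sound : ∀ {t u A} → Γ ⊢ t ∶ A → t ⟶ u → f t ≋ f u) where

    —↠-sound : ∀ {t u A} → Γ ⊢ t ∶ A → t —↠ u → f t ≋ f u
    —↠-sound d nil      = ≋-refl
    —↠-sound d (r ◅ rs) =
      ≋-trans (sound d r) (—↠-sound (subject-reduction d r) rs)

    -- A conversion may pass through untyped terms. Confluence replaces it by two reductions
    -- starting from the typed ends, and subject reduction keeps these typed.
    ↔-sound : ∀ {A B A′ B′} → Γ ⊢ A ∶ A′ → Γ ⊢ B ∶ B′ → A ↔ B → f A ≋ f B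
    ↔-sound d e c = let _ , p , q = church-rosser c in
      ≋-trans (—↠-sound d p) (≋-sym (—↠-sound e q))

    ≼-sound : ∀ {A B} → Γ ⊢ A ≼ B → f A ≋ f B
    ≼-sound same         = ≋-refl
    ≼-sound (conv p q c) = ↔-sound p q c

-- Interpretation

module Semantics (𝓑 : ΠAlgebra) (full : ΠAlgebra.Full 𝓑) where

  open ΠAlgebra 𝓑

  -- A copy of the carrier, with ∅ added as another name of ⊤̃.  With it in
  -- place of the carrier, ∅ belongs to the third-level value of every type, so
  -- that the sets to which Π̃ is applied are not empty.
  Truth : 𝕍
  Truth = sup (Maybe El) λ where
    nothing  → ∅
    (just a) → sing ⟪ a ⟫

  value : Maybe El → El
  value = fromMaybe ⊤̃

  -- The carrier may itself contain ∅, but ∅ is never a singleton: this is why the copies of its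
  -- elements in `Truth` are wrapped in `sing`.
  value-cong : ∀ i j → elt Truth i ≋ elt Truth j → ⟪ value i ⟫ ≋ ⟪ value j ⟫
  value-cong nothing  nothing  e = ≋-refl
  value-cong nothing  (just _) e = ∅≢sing e
  value-cong (just _) nothing  e = ∅≢sing (≋-sym e)
  value-cong (just _) (just _) e = sing-injective e

  ∅∈Truth : ∅ ϵ Truth
  ∅∈Truth = elt∈ nothing

  sing∈Truth : ∀ a → sing ⟪ a ⟫ ϵ Truth
  sing∈Truth a = elt∈ (just a)

  members : ∀ {I : Set} → (I → El) → 𝕍
  members {I} f = sup I (λ i → ⟪ f i ⟫)

  members-𝒫⁺ : ∀ {I : Set} → I → (f : I → El) → 𝒫⁺ (members f)
  members-𝒫⁺ i f = (λ j → f j , ≈-refl ⟪ f j ⟫) , i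

  -- The argument in `I` witnesses that the family is not empty, so that fullness applies.
  ∏ : El → {I : Set} → I → (I → El) → El
  ∏ a i f = Π̃ a (members f) (full (members-𝒫⁺ i f))

  ∏-cong : ∀ {a b} {I J : Set} {i : I} {j : J} {f : I → El} {g : J → El} →
           ⟪ a ⟫ ≋ ⟪ b ⟫ → members f ≋ members g → ⟪ ∏ a i f ⟫ ≋ ⟪ ∏ b j g ⟫
  ∏-cong {i = i} {j} {f} {g} e e′ =
    wrap (Π̃-cong (full (members-𝒫⁺ i f)) (full (members-𝒫⁺ j g))
                 (unwrap e) (unwrap e′))

  opaque
    -- Π̃ (v , S) if v is in the carrier and S in 𝒜.  As this cannot be decided,
    -- it is the union of Π̃ a S p over all a ≈ v and p : 𝒜 S.
    Product : 𝕍 → 𝕍 → 𝕍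
    Product v S =
      sup (Σ[ a ∈ El ] Σ[ p ∈ 𝒜 S ] ⟪ a ⟫ ≋ v × index ⟪ Π̃ a S p ⟫)
          (λ (a , p , _ , i) → elt ⟪ Π̃ a S p ⟫ i)

    Product-value : ∀ {a v S} → ⟪ a ⟫ ≋ v → (p : 𝒜 S) →
                    Product v S ≋ ⟪ Π̃ a S p ⟫
    Product-value {a} {S = S} e p = ≋-ext
      (λ (b , q , e′ , i) → ∈-respʳ
        (wrap (Π̃-cong q p (unwrap (≋-trans e′ (≋-sym e))) (≈-refl S))) (elt∈ i))
      (λ i → elt∈ (a , p , e , i))

    Product-cong : ∀ {v w S T} → v ≋ w → S ≋ T → Product v S ≋ Product w T
    Product-cong e e′ = ≋-ext (⊆ e e′) (⊆ (≋-sym e) (≋-sym e′))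
      where
      ⊆ : ∀ {v w S T} → v ≋ w → S ≋ T →
          ∀ i → elt (Product v S) i ϵ Product w T
      ⊆ {S = S} {T} e e′ (a , p , e″ , i) =
        let q = 𝒜-resp (unwrap e′) p
            at j r = ∈-respʳ (wrap (Π̃-cong p q (≈-refl ⟪ a ⟫) (unwrap e′))) (elt∈ i)
        in at (a , q , ≋-trans e″ e , j) r

  image : (D S : 𝕍) → (index D → index S → 𝕍) → 𝕍
  image D S F = sup (index D × index S) λ (i , j) → F i j

  image-cong : ∀ {D D′ S S′} {F : index D → index S → 𝕍}
               {F′ : index D′ → index S′ → 𝕍} → D ≋ D′ → S ≋ S′ →
               (∀ i i′ j j′ → elt D i ≋ elt D′ i′ → elt S j ≋ elt S′ j′ →
                F i j ≋ F′ i′ j′) →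
               image D S F ≋ image D′ S′ F′
  image-cong e e′ e″ = ≋-ext
    (λ (i , j) → let at i′ p = ∈-respʳ e (elt∈ i)
                     at j′ q = ∈-respʳ e′ (elt∈ j)
                 in at (i′ , j′) (e″ i i′ j j′ p q))
    (λ (i′ , j′) → let at i p = ∈-respʳ (≋-sym e) (elt∈ i′)
                       at j q = ∈-respʳ (≋-sym e′) (elt∈ j′)
                   in at (i , j) (≋-sym (e″ i i′ j j′ (≋-sym p) (≋-sym q))))

  -- Simple types and the ranges of the interpretation

  data Ty : Set where
    base : Ty
    _↦_  : Ty → Ty → Ty

  -- `base` serves for both ι and o. The clause for arrows is the third-level value of a product of
  -- two types η, `One` being the second-level value of its domain; this lets η be the identity.
  ty : Ty → 𝕍
  ty base    = Truth
  ty (a ↦ b) = Pi₂ One (ty a) λ _ → ty b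

  Types : 𝕍
  Types = sup Ty ty

  ∅∈ty : ∀ a → ∅ ϵ ty a
  ∅∈ty base    = ∅∈Truth
  ∅∈ty (a ↦ b) = ∅∈Pi λ _ → ∅∈Pi λ _ → ∅∈ty b

  instance∈ : ∀ a f z →
              app₂ (elt (ty (a ↦ base)) f) ∅ (elt (ty a) z) ϵ Truth
  instance∈ a f z = Pi-app (Pi-app (elt∈ f) tt) z

  -- The truth values of the predicate `f` at each `z`, over which ∀ takes its product. The argument
  -- ∅ in `instance∈` is the third-level value of an object of type η.
  instances : ∀ a → index (ty (a ↦ base)) → index (ty a) → El
  instances a f z = value (ix (instance∈ a f z))

  -- dom c is a second-level value of a type, kdom c one of a kind, and set c a
  -- third-level value of a type (s = ⋆) or of a kind (s = □).

  data Domain : Set where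
    one types : Domain
    _↦_       : Domain → Domain → Domain

  dom : Domain → 𝕍
  dom one     = One
  dom types   = Types
  dom (c ↦ d) = Pi (dom c) λ _ → dom d

  data Family : Sort → Set where
    truth unit : Family ⋆
    truths     : Family □
    pi         : ∀ {s} (c : Domain) → Family ⋆ → (index (dom c) → Family s) →
                 Family s

  set : ∀ {s} → Family s → 𝕍
  set truth      = Truth
  set unit       = One
  set truths     = carrier
  set (pi c d e) = Pi₂ (dom c) (set d) λ i → set (e i)

  Sets : Sort → 𝕍
  Sets s = sup (Family s) set

  data KindDomain : Set where
    sets : KindDomain
    _↦_  : Domain → KindDomain → KindDomain

  kdom : KindDomain → 𝕍
  kdom sets    = Sets ⋆
  kdom (c ↦ d) = Pi (dom c) λ _ → kdom d

  Domains : Sort → 𝕍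
  Domains ⋆ = sup Domain dom
  Domains □ = sup KindDomain kdom

  -- Values of the constants

  con₁ con₂ con₃ : Symbol → 𝕍

  con₁ type = Types
  con₁ η    = One
  con₁ ε    = One
  con₁ _    = ∅

  con₂ type  = Truth
  con₂ ι     = Truth
  con₂ o     = Truth
  con₂ arrow = lam Types λ a → lam Types λ b → ty (a ↦ b)
  con₂ η     = lam Types ty
  con₂ ⇒̇     = ∅
  con₂ ∀̇     = ∅
  con₂ ε     = lam One λ _ → One

  -- Objects of type `type` or η o have names in `Truth` as fourth-level values. So η and ε read the
  -- truth value off a name, while `arrow`, ⇒ and ∀ apply `sing` to return a name.
  con₃ type  = ⟪ ⊤̃ ⟫
  con₃ ι     = ∅
  con₃ o     = ∅
  con₃ arrow = lam₂ Types Truth λ _ i → lam₂ Types Truth λ _ j →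
               sing ⟪ ∏ (value i) tt (λ _ → value j) ⟫
  con₃ η     = lam₂ Types Truth λ _ i → ⟪ value i ⟫
  con₃ ⇒̇     = lam₂ One Truth λ _ i → lam₂ One Truth λ _ j →
               sing ⟪ ∏ (value i) tt (λ _ → value j) ⟫
  -- The antecedent `value i` is the truth value of the type quantified over, as in the contractum
  -- of the ∀ rule; ∅ in `ty a` shows that there are instances.
  con₃ ∀̇     = lam₂ Types Truth λ a i → lam₂ One (ty (a ↦ base)) λ _ f →
               sing ⟪ ∏ (value i) (ix (∅∈ty a)) (instances a f) ⟫
  con₃ ε     = lam₂ One Truth λ _ i → ⟪ value i ⟫

  -- The four levels

  Val : ℕ → Set₁
  Val = Vector 𝕍

  D₀ : ∀ {k} → Term Symbol k → 𝕍
  D₀ (sort s) = Domains s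
  D₀ (Π A B)  = D₀ B
  D₀ _        = One

  -- A bound variable gets the value ∅, the only element of `D₀ A` when `A` is a type; `D₂` and `D₃`
  -- extend their first valuation in the same way.
  D₁ : ∀ {k} → Term Symbol k → Val k → 𝕍
  D₁ (var x)  φ = φ x
  D₁ (con c)  φ = con₁ c
  D₁ (sort s) φ = Sets s
  D₁ (Π A B)  φ = Pi (D₁ A φ) λ _ → D₁ B (∅ ◂ φ)
  D₁ (ƛ A t)  φ = D₁ t (∅ ◂ φ)
  D₁ (t · u)  φ = D₁ t φ

  D₂ : ∀ {k} → Term Symbol k → Val k → Val k → 𝕍
  D₂ (var x)  φ₁ φ₂ = φ₂ x
  D₂ (con c)  φ₁ φ₂ = con₂ c
  D₂ (sort s) φ₁ φ₂ = carrier
  D₂ (Π A B)  φ₁ φ₂ = Pi₂ (D₁ A φ₁) (D₂ A φ₁ φ₂) λ i →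
                      D₂ B (∅ ◂ φ₁) (elt (D₁ A φ₁) i ◂ φ₂)
  D₂ (ƛ A t)  φ₁ φ₂ = lam (D₁ A φ₁) λ i → D₂ t (∅ ◂ φ₁) (elt (D₁ A φ₁) i ◂ φ₂)
  D₂ (t · u)  φ₁ φ₂ = app (D₂ t φ₁ φ₂) (D₂ u φ₁ φ₂)

  D₃ : ∀ {k} → Term Symbol k → Val k → Val k → Val k → 𝕍
  D₃ (var x)  φ₁ φ₂ φ₃ = φ₃ x
  D₃ (con c)  φ₁ φ₂ φ₃ = con₃ c
  D₃ (sort s) φ₁ φ₂ φ₃ = ⟪ ⊤̃ ⟫
  D₃ (Π A B)  φ₁ φ₂ φ₃ =
    Product (D₃ A φ₁ φ₂ φ₃) (image (D₁ A φ₁) (D₂ A φ₁ φ₂) λ i j →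
      D₃ B (∅ ◂ φ₁) (elt (D₁ A φ₁) i ◂ φ₂) (elt (D₂ A φ₁ φ₂) j ◂ φ₃))
  D₃ (ƛ A t)  φ₁ φ₂ φ₃ =
    lam₂ (D₁ A φ₁) (D₂ A φ₁ φ₂) λ i j →
    D₃ t (∅ ◂ φ₁) (elt (D₁ A φ₁) i ◂ φ₂) (elt (D₂ A φ₁ φ₂) j ◂ φ₃)
  D₃ (t · u)  φ₁ φ₂ φ₃ =
    app₂ (D₃ t φ₁ φ₂ φ₃) (D₂ u φ₁ φ₂) (D₃ u φ₁ φ₂ φ₃)

  -- Renaming, congruence and substitution

  infix 4 _≗ᵛ_
  _≗ᵛ_ : ∀ {k} → Val k → Val k → Set
  φ ≗ᵛ ψ = ∀ x → φ x ≋ ψ x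

  lift-≗ : ∀ {k l} {ρ : Fin k → Fin l} {φ ψ a b} → φ ∘ ρ ≗ᵛ ψ → a ≋ b →
           (a ◂ φ) ∘ lift {Symbol} ρ ≗ᵛ b ◂ ψ
  lift-≗ h e zero    = e
  lift-≗ h e (suc x) = h x

  -- Comparing the valuations only up to equality of sets makes congruence the case of the identity
  -- renaming.
  D₁-rename : ∀ {k l} {ρ : Fin k → Fin l} {φ ψ} t → φ ∘ ρ ≗ᵛ ψ →
              D₁ (rename ρ t) φ ≋ D₁ t ψ
  D₁-rename (var x)  h = h x
  D₁-rename (con c)  h = ≋-refl
  D₁-rename (sort s) h = ≋-refl
  D₁-rename (Π A B)  h = Pi-cong (D₁-rename A h) λ _ _ _ →
                         D₁-rename B (lift-≗ h ≋-refl)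
  D₁-rename (ƛ A t)  h = D₁-rename t (lift-≗ h ≋-refl)
  D₁-rename (t · u)  h = D₁-rename t h

  D₂-rename : ∀ {k l} {ρ : Fin k → Fin l} {φ₁ ψ₁ φ₂ ψ₂} t →
              φ₁ ∘ ρ ≗ᵛ ψ₁ → φ₂ ∘ ρ ≗ᵛ ψ₂ → D₂ (rename ρ t) φ₁ φ₂ ≋ D₂ t ψ₁ ψ₂
  D₂-rename (var x)  h₁ h₂ = h₂ x
  D₂-rename (con c)  h₁ h₂ = ≋-refl
  D₂-rename (sort s) h₁ h₂ = ≋-refl
  D₂-rename (Π A B)  h₁ h₂ =
    Pi₂-cong (D₁-rename A h₁) (D₂-rename A h₁ h₂) λ i j e →
    D₂-rename B (lift-≗ h₁ ≋-refl) (lift-≗ h₂ e)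
  D₂-rename (ƛ A t)  h₁ h₂ = lam-cong (D₁-rename A h₁) λ i j e →
    D₂-rename t (lift-≗ h₁ ≋-refl) (lift-≗ h₂ e)
  D₂-rename (t · u)  h₁ h₂ = app-cong (D₂-rename t h₁ h₂) (D₂-rename u h₁ h₂)

  D₃-rename : ∀ {k l} {ρ : Fin k → Fin l} {φ₁ ψ₁ φ₂ ψ₂ φ₃ ψ₃} t →
              φ₁ ∘ ρ ≗ᵛ ψ₁ → φ₂ ∘ ρ ≗ᵛ ψ₂ → φ₃ ∘ ρ ≗ᵛ ψ₃ →
              D₃ (rename ρ t) φ₁ φ₂ φ₃ ≋ D₃ t ψ₁ ψ₂ ψ₃
  D₃-rename (var x)  h₁ h₂ h₃ = h₃ x
  D₃-rename (con c)  h₁ h₂ h₃ = ≋-refl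
  D₃-rename (sort s) h₁ h₂ h₃ = ≋-refl
  D₃-rename (Π A B)  h₁ h₂ h₃ = Product-cong (D₃-rename A h₁ h₂ h₃)
    (image-cong (D₁-rename A h₁) (D₂-rename A h₁ h₂) λ i i′ j j′ e e′ →
     D₃-rename B (lift-≗ h₁ ≋-refl) (lift-≗ h₂ e) (lift-≗ h₃ e′))
  D₃-rename (ƛ A t)  h₁ h₂ h₃ =
    lam₂-cong (D₁-rename A h₁) (D₂-rename A h₁ h₂) λ i i′ j j′ e e′ →
    D₃-rename t (lift-≗ h₁ ≋-refl) (lift-≗ h₂ e) (lift-≗ h₃ e′)
  D₃-rename (t · u)  h₁ h₂ h₃ =
    app₂-cong (D₃-rename t h₁ h₂ h₃) (D₂-rename u h₁ h₂) (D₃-rename u h₁ h₂ h₃)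

  rename-id : ∀ {C k} {ρ : Fin k → Fin k} → (∀ x → ρ x ≡ x) →
              (t : Term C k) → rename ρ t ≡ t
  rename-id h (var x)  = cong var (h x)
  rename-id h (con c)  = refl
  rename-id h (sort s) = refl
  rename-id h (Π A B)  = cong₂ Π (rename-id h A) (rename-id (λ where
    zero    → refl
    (suc x) → cong suc (h x)) B)
  rename-id h (ƛ A t)  = cong₂ ƛ (rename-id h A) (rename-id (λ where
    zero    → refl
    (suc x) → cong suc (h x)) t)
  rename-id h (t · u)  = cong₂ _·_ (rename-id h t) (rename-id h u)

  D₁-cong : ∀ {k} {φ ψ : Val k} t → φ ≗ᵛ ψ → D₁ t φ ≋ D₁ t ψ
  D₁-cong {φ = φ} t h with D₁-rename {ρ = λ x → x} {φ} t h
  ... | e rewrite rename-id {ρ = λ x → x} (λ _ → refl) t = e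

  D₂-cong : ∀ {k} {φ₁ ψ₁ φ₂ ψ₂ : Val k} t → φ₁ ≗ᵛ ψ₁ → φ₂ ≗ᵛ ψ₂ →
            D₂ t φ₁ φ₂ ≋ D₂ t ψ₁ ψ₂
  D₂-cong {φ₁ = φ₁} {φ₂ = φ₂} t h₁ h₂
    with D₂-rename {ρ = λ x → x} {φ₁ = φ₁} {φ₂ = φ₂} t h₁ h₂
  ... | e rewrite rename-id {ρ = λ x → x} (λ _ → refl) t = e

  D₃-cong : ∀ {k} {φ₁ ψ₁ φ₂ ψ₂ φ₃ ψ₃ : Val k} t → φ₁ ≗ᵛ ψ₁ → φ₂ ≗ᵛ ψ₂ →
            φ₃ ≗ᵛ ψ₃ → D₃ t φ₁ φ₂ φ₃ ≋ D₃ t ψ₁ ψ₂ ψ₃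
  D₃-cong {φ₁ = φ₁} {φ₂ = φ₂} {φ₃ = φ₃} t h₁ h₂ h₃
    with D₃-rename {ρ = λ x → x} {φ₁ = φ₁} {φ₂ = φ₂} {φ₃ = φ₃} t h₁ h₂ h₃
  ... | e rewrite rename-id {ρ = λ x → x} (λ _ → refl) t = e

  ◂-≗ : ∀ {k} {φ ψ : Val k} {a b} → a ≋ b → φ ≗ᵛ ψ → a ◂ φ ≗ᵛ b ◂ ψ
  ◂-≗ e h zero    = e
  ◂-≗ e h (suc x) = h x

  ≗-refl : ∀ {k} {φ : Val k} → φ ≗ᵛ φ
  ≗-refl x = ≋-refl

  module _ {k l : ℕ} {θ : Fin k → Term Symbol l} {φ₁ : Val l} where
    lifts₁ : ∀ {ψ₁} → (∀ x → D₁ (θ x) φ₁ ≋ ψ₁ x) → ∀ {a b} → a ≋ b → ∀ x →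
             D₁ (lifts θ x) (a ◂ φ₁) ≋ (b ◂ ψ₁) x
    lifts₁ h e zero    = e
    lifts₁ h e (suc x) = ≋-trans (D₁-rename (θ x) ≗-refl) (h x)

    lifts₂ : ∀ {φ₂ ψ₂} → (∀ x → D₂ (θ x) φ₁ φ₂ ≋ ψ₂ x) →
             ∀ {a b c} → b ≋ c → ∀ x →
             D₂ (lifts θ x) (a ◂ φ₁) (b ◂ φ₂) ≋ (c ◂ ψ₂) x
    lifts₂ h e zero    = e
    lifts₂ h e (suc x) = ≋-trans (D₂-rename (θ x) ≗-refl ≗-refl) (h x)

    lifts₃ : ∀ {φ₂ φ₃ ψ₃} → (∀ x → D₃ (θ x) φ₁ φ₂ φ₃ ≋ ψ₃ x) →
             ∀ {a b c d} → c ≋ d → ∀ x →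
             D₃ (lifts θ x) (a ◂ φ₁) (b ◂ φ₂) (c ◂ φ₃) ≋ (d ◂ ψ₃) x
    lifts₃ h e zero    = e
    lifts₃ h e (suc x) = ≋-trans (D₃-rename (θ x) ≗-refl ≗-refl ≗-refl) (h x)

  -- The interpretation is compositional from the second level on, so substitution is interpreted
  -- correctly for all terms, typed or not.
  D₁-subst : ∀ {k l} {θ : Fin k → Term Symbol l} {φ ψ} t →
             (∀ x → D₁ (θ x) φ ≋ ψ x) → D₁ (subst θ t) φ ≋ D₁ t ψ
  D₁-subst (var x)  h = h x
  D₁-subst (con c)  h = ≋-refl
  D₁-subst (sort s) h = ≋-refl
  D₁-subst (Π A B)  h =
    Pi-cong (D₁-subst A h) λ _ _ _ → D₁-subst B (lifts₁ h ≋-refl)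
  D₁-subst (ƛ A t)  h = D₁-subst t (lifts₁ h ≋-refl)
  D₁-subst (t · u)  h = D₁-subst t h

  D₂-subst : ∀ {k l} {θ : Fin k → Term Symbol l} {φ₁ φ₂ ψ₁ ψ₂} t →
             (∀ x → D₁ (θ x) φ₁ ≋ ψ₁ x) → (∀ x → D₂ (θ x) φ₁ φ₂ ≋ ψ₂ x) →
             D₂ (subst θ t) φ₁ φ₂ ≋ D₂ t ψ₁ ψ₂
  D₂-subst (var x)  h₁ h₂ = h₂ x
  D₂-subst (con c)  h₁ h₂ = ≋-refl
  D₂-subst (sort s) h₁ h₂ = ≋-refl
  D₂-subst (Π A B)  h₁ h₂ =
    Pi₂-cong (D₁-subst A h₁) (D₂-subst A h₁ h₂) λ i j e →
    D₂-subst B (lifts₁ h₁ ≋-refl) (lifts₂ h₂ e)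
  D₂-subst (ƛ A t)  h₁ h₂ = lam-cong (D₁-subst A h₁) λ i j e →
    D₂-subst t (lifts₁ h₁ ≋-refl) (lifts₂ h₂ e)
  D₂-subst (t · u)  h₁ h₂ = app-cong (D₂-subst t h₁ h₂) (D₂-subst u h₁ h₂)

  D₃-subst : ∀ {k l} {θ : Fin k → Term Symbol l} {φ₁ φ₂ φ₃ ψ₁ ψ₂ ψ₃} t →
             (∀ x → D₁ (θ x) φ₁ ≋ ψ₁ x) → (∀ x → D₂ (θ x) φ₁ φ₂ ≋ ψ₂ x) →
             (∀ x → D₃ (θ x) φ₁ φ₂ φ₃ ≋ ψ₃ x) →
             D₃ (subst θ t) φ₁ φ₂ φ₃ ≋ D₃ t ψ₁ ψ₂ ψ₃
  D₃-subst (var x)  h₁ h₂ h₃ = h₃ x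
  D₃-subst (con c)  h₁ h₂ h₃ = ≋-refl
  D₃-subst (sort s) h₁ h₂ h₃ = ≋-refl
  D₃-subst (Π A B)  h₁ h₂ h₃ = Product-cong (D₃-subst A h₁ h₂ h₃)
    (image-cong (D₁-subst A h₁) (D₂-subst A h₁ h₂) λ i i′ j j′ e e′ →
     D₃-subst B (lifts₁ h₁ ≋-refl) (lifts₂ h₂ e) (lifts₃ h₃ e′))
  D₃-subst (ƛ A t)  h₁ h₂ h₃ =
    lam₂-cong (D₁-subst A h₁) (D₂-subst A h₁ h₂) λ i i′ j j′ e e′ →
    D₃-subst t (lifts₁ h₁ ≋-refl) (lifts₂ h₂ e) (lifts₃ h₃ e′)
  D₃-subst (t · u)  h₁ h₂ h₃ =
    app₂-cong (D₃-subst t h₁ h₂ h₃) (D₂-subst u h₁ h₂) (D₃-subst u h₁ h₂ h₃)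

  module _ {k : ℕ} (u : Term Symbol k) where
    D₁-[] : ∀ {φ₁} t → D₁ (t [ u ]) φ₁ ≋ D₁ t (D₁ u φ₁ ◂ φ₁)
    D₁-[] t = D₁-subst t λ where
      zero    → ≋-refl
      (suc x) → ≋-refl

    D₂-[] : ∀ {φ₁ φ₂} t →
            D₂ (t [ u ]) φ₁ φ₂ ≋ D₂ t (D₁ u φ₁ ◂ φ₁) (D₂ u φ₁ φ₂ ◂ φ₂)
    D₂-[] t = D₂-subst t
      (λ where zero    → ≋-refl
               (suc x) → ≋-refl)
      (λ where zero    → ≋-refl
               (suc x) → ≋-refl)

    D₃-[] : ∀ {φ₁ φ₂ φ₃} t → D₃ (t [ u ]) φ₁ φ₂ φ₃ ≋
            D₃ t (D₁ u φ₁ ◂ φ₁) (D₂ u φ₁ φ₂ ◂ φ₂) (D₃ u φ₁ φ₂ φ₃ ◂ φ₃)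
    D₃-[] t = D₃-subst t
      (λ where zero    → ≋-refl
               (suc x) → ≋-refl)
      (λ where zero    → ≋-refl
               (suc x) → ≋-refl)
      (λ where zero    → ≋-refl
               (suc x) → ≋-refl)

-- Soundness

module Soundness (𝓑 : ΠAlgebra) (full : ΠAlgebra.Full 𝓑)
                 (confluent : Theory.ConfluentReduction STT)
                 (subject-reduction : Theory.SubjectReduction STT) where

  open ΠAlgebra 𝓑
  open Semantics 𝓑 full
  open Reduction confluent subject-reduction

  -- First and second levels

  D₀-rename : ∀ {k l} (ρ : Fin k → Fin l) t → D₀ (rename ρ t) ≡ D₀ t
  D₀-rename ρ (var x)  = refl
  D₀-rename ρ (con c)  = refl
  D₀-rename ρ (sort s) = refl
  D₀-rename ρ (Π A B)  = D₀-rename (lift {Symbol} ρ) B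
  D₀-rename ρ (ƛ A t)  = refl
  D₀-rename ρ (t · u)  = refl

  D₀-Object : ∀ {k} {t : Tm k} → Object t → D₀ t ≡ One
  D₀-Object (var x) = refl
  D₀-Object (con c) = refl
  D₀-Object (Π p q) = D₀-Object q
  D₀-Object (ƛ p q) = refl
  D₀-Object (p · q) = refl

  D₀-IsKind : ∀ {k} {t : Tm k} → IsKind t → D₀ t ≡ Domains ⋆
  D₀-IsKind type    = refl
  D₀-IsKind (Π p q) = D₀-IsKind q

  -- `D₀` looks at the shape of a term, which substituting a sort for a variable could change;
  -- objects leave its class unchanged.
  D₀-subst : ∀ {k l} {θ : Fin k → Tm l} {A} → Objects θ → IsType A →
             D₀ (subst θ A) ≡ D₀ A
  D₀-subst h (inj₁ p) =
    trans (D₀-Object (Object-subst h p)) (sym (D₀-Object p))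
  D₀-subst h (inj₂ p) =
    trans (D₀-IsKind (IsKind-subst h p)) (sym (D₀-IsKind p))

  -- `D₀` only tells objects from kinds, and by subject reduction the reduct has the same type,
  -- hence belongs to the same class.
  sound₀ : ∀ {k} {Γ : Ctx Symbol k} {t u A} → Γ ⊢ t ∶ A → t ⟶ u → D₀ t ≋ D₀ u
  sound₀ d r with classify d | classify (subject-reduction d r)
  ... | object p _    | object q _  =
    ≡⇒≋ (trans (D₀-Object p) (sym (D₀-Object q)))
  ... | kind p _      | kind q _    =
    ≡⇒≋ (trans (D₀-IsKind p) (sym (D₀-IsKind q)))
  ... | object _ (inj₁ ()) | kind _ refl
  ... | object _ (inj₂ ()) | kind _ refl
  ... | kind _ refl   | object _ (inj₁ ())
  ... | kind _ refl   | object _ (inj₂ ())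

  Valid₁ : ∀ {k} → Ctx Symbol k → Val k → Set
  Valid₁ Γ φ₁ = ∀ x → φ₁ x ϵ D₀ (lookup Γ x)

  Valid₂ : ∀ {k} → Ctx Symbol k → Val k → Val k → Set
  Valid₂ Γ φ₁ φ₂ = ∀ x → φ₂ x ϵ D₁ (lookup Γ x) φ₁

  Valid₃ : ∀ {k} → Ctx Symbol k → Val k → Val k → Val k → Set
  Valid₃ Γ φ₁ φ₂ φ₃ = ∀ x → φ₃ x ϵ D₂ (lookup Γ x) φ₁ φ₂

  D₁-weaken : ∀ {k} {φ : Val k} {a} t → D₁ t φ ≋ D₁ (weaken t) (a ◂ φ)
  D₁-weaken t = ≋-sym (D₁-rename t ≗-refl)

  D₂-weaken : ∀ {k} {φ₁ φ₂ : Val k} {a b} t →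
              D₂ t φ₁ φ₂ ≋ D₂ (weaken t) (a ◂ φ₁) (b ◂ φ₂)
  D₂-weaken t = ≋-sym (D₂-rename t ≗-refl ≗-refl)

  D₃-weaken : ∀ {k} {φ₁ φ₂ φ₃ : Val k} {a b c} t →
              D₃ t φ₁ φ₂ φ₃ ≋ D₃ (weaken t) (a ◂ φ₁) (b ◂ φ₂) (c ◂ φ₃)
  D₃-weaken t = ≋-sym (D₃-rename t ≗-refl ≗-refl ≗-refl)

  module _ {k : ℕ} {Γ : Ctx Symbol k} {A : Tm k} {φ₁ : Val k} where

    ▷₁ : Γ ⊢ A ∶ Type → Valid₁ Γ φ₁ → Valid₁ (Γ ▷ A) (∅ ◂ φ₁)
    ▷₁ d v zero    = ∈-respʳ
      (≡⇒≋ (sym (trans (D₀-rename suc A) (D₀-Object (type-Object d))))) ∅∈One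
    ▷₁ d v (suc x) = ∈-respʳ (≡⇒≋ (sym (D₀-rename suc (lookup Γ x)))) (v x)

    ▷₂ : ∀ {φ₂ a b} → Valid₂ Γ φ₁ φ₂ → b ϵ D₁ A φ₁ →
         Valid₂ (Γ ▷ A) (a ◂ φ₁) (b ◂ φ₂)
    ▷₂ v p zero    = ∈-respʳ (D₁-weaken A) p
    ▷₂ v p (suc x) = ∈-respʳ (D₁-weaken (lookup Γ x)) (v x)

    ▷₃ : ∀ {φ₂ φ₃ a b c} → Valid₃ Γ φ₁ φ₂ φ₃ → c ϵ D₂ A φ₁ φ₂ →
         Valid₃ (Γ ▷ A) (a ◂ φ₁) (b ◂ φ₂) (c ◂ φ₃)
    ▷₃ v p zero    = ∈-respʳ (D₂-weaken A) p
    ▷₃ v p (suc x) = ∈-respʳ (D₂-weaken (lookup Γ x)) (v x)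

  con₁∈ : ∀ {k} c → con₁ c ϵ D₀ (close {k = k} (typeOf c))
  con₁∈ type  = elt∈ types
  con₁∈ ι     = ∅∈One
  con₁∈ o     = ∅∈One
  con₁∈ arrow = ∅∈One
  con₁∈ η     = elt∈ one
  con₁∈ ⇒̇     = ∅∈One
  con₁∈ ∀̇     = ∅∈One
  con₁∈ ε     = elt∈ one

  Fun-cong : ∀ {D D′ E E′ : 𝕍} → D ≋ D′ → E ≋ E′ →
             Pi D (λ _ → E) ≋ Pi D′ (λ _ → E′)
  Fun-cong e e′ = Pi-cong e λ _ _ _ → e′

  member₁ : ∀ {k} {Γ : Ctx Symbol k} {t A} → Γ ⊢ t ∶ A → ∀ {φ₁} →
            Valid₁ Γ φ₁ → D₁ t φ₁ ϵ D₀ A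
  member₁ (⊢type w) v = elt∈ sets
  member₁ (⊢var w x) v = v x
  member₁ (⊢con {c} w m) v with refl ← ∈⇒typeOf m = con₁∈ c
  member₁ (⊢Π ⋆ d e) v =
    let at a p = member₁ d v ; at b q = member₁ e (▷₁ d v) in
    at (a ↦ b) (Fun-cong p q)
  member₁ (⊢Π □ d e) v =
    let at a p = member₁ d v ; at b q = member₁ e (▷₁ d v) in
    at (a ↦ b) (Fun-cong p q)
  member₁ (⊢ƛ s d e f) v = member₁ f (▷₁ d v)
  member₁ (⊢· d e) v with classify d | classify e
  ... | object _ i | object q _ =
    ∈-respʳ (≡⇒≋ (sym (D₀-subst (Objects-[] q) (IsType-cod i)))) (member₁ d v)
  ... | object _ i | kind _ refl with () ← IsType-dom i
  member₁ (⊢conv s d e f c) v =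
    ∈-respʳ (↔-sound D₀ sound₀ d e c) (member₁ f v)

  -- Justifies giving ∅ to bound variables: it is the value of whatever is substituted for them.
  value₁ : ∀ {k} {Γ : Ctx Symbol k} {t A} → Γ ⊢ t ∶ A → Object A →
           ∀ {φ₁} → Valid₁ Γ φ₁ → D₁ t φ₁ ≋ ∅
  value₁ d p v = ∈One (member₁ d v) (≡⇒≋ (D₀-Object p))

  module _ {k : ℕ} {Γ : Ctx Symbol k} where

    Π-Object : ∀ {t A B} → Γ ⊢ t ∶ Π A B → Object A
    Π-Object d with classify d
    ... | object _ i = IsType-dom i

    β-inversion : ∀ {A t u C} → Γ ⊢ ƛ A t · u ∶ C →
                  Γ ⊢ A ∶ Type × (∃[ B ] Γ ▷ A ⊢ t ∶ B) × Γ ⊢ u ∶ A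
    β-inversion d = let _ , _ , e , f = ·-inversion d
                        _ , a , b , g = ƛ-inversion e
                    in a , (_ , b) , ⊢dom g f

  sound₁ : ∀ {k} {Γ : Ctx Symbol k} {t u A φ₁} → Valid₁ Γ φ₁ →
           Γ ⊢ t ∶ A → t ⟶ u → D₁ t φ₁ ≋ D₁ u φ₁
  sound₁ v d (root (inj₁ (beta {A} {t} {u}))) =
    let a , _ , f = β-inversion d in ≋-sym (≋-trans (D₁-[] u t)
      (D₁-cong t (◂-≗ (value₁ f (type-Object a) v) ≗-refl)))
  -- In all three rules the redex has the value of η or ε, namely `One`, and the contractum is a
  -- product of `One`.
  sound₁ v d (root (inj₂ (instantiate arrow-rule∈ θ))) =
    ≋-sym (Pi-One λ _ → ≋-refl)
  sound₁ v d (root (inj₂ (instantiate ⇒-rule∈ θ)))     =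
    ≋-sym (Pi-One λ _ → ≋-refl)
  sound₁ v d (root (inj₂ (instantiate ∀-rule∈ θ)))     =
    ≋-sym (Pi-One λ _ → ≋-refl)
  sound₁ v d (Π₁ r) = Fun-cong (sound₁ v (proj₁ (Π-inversion d)) r) ≋-refl
  sound₁ v d (Π₂ r) = let a , _ , b = Π-inversion d in
    Fun-cong ≋-refl (sound₁ (▷₁ a v) b r)
  sound₁ v d (ƛ₁ r) = ≋-refl
  sound₁ v d (ƛ₂ r) = let _ , a , b , _ = ƛ-inversion d in sound₁ (▷₁ a v) b r
  sound₁ v d (·₁ r) = let _ , _ , e , _ = ·-inversion d in sound₁ v e r
  sound₁ v d (·₂ r) = ≋-refl

  module _ {k : ℕ} {Γ : Ctx Symbol k} {φ₁ : Val k} (v : Valid₁ Γ φ₁) where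
    ↔-sound₁ : ∀ {A B A′ B′} → Γ ⊢ A ∶ A′ → Γ ⊢ B ∶ B′ → A ↔ B →
               D₁ A φ₁ ≋ D₁ B φ₁
    ↔-sound₁ = ↔-sound (λ t → D₁ t φ₁) (sound₁ v)

    ≼-sound₁ : ∀ {A B} → Γ ⊢ A ≼ B → D₁ A φ₁ ≋ D₁ B φ₁
    ≼-sound₁ = ≼-sound (λ t → D₁ t φ₁) (sound₁ v)

  -- Third level

  ↦-cong : ∀ {a a′ b b′} → ty a ≋ ty a′ → ty b ≋ ty b′ → ty (a ↦ b) ≋ ty (a′ ↦ b′)
  ↦-cong e e′ = Pi₂-cong ≋-refl e λ _ _ _ → e′

  -- Needed for the identity on `Types` to be a value of η: its results must lie in `Sets ⋆`, the
  -- second-level value of `Type`.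
  ty∈Sets : ∀ a → ty a ϵ Sets ⋆
  ty∈Sets base    = elt∈ truth
  ty∈Sets (a ↦ b) =
    let at c p = ty∈Sets a ; at d q = ty∈Sets b in
    at (pi one c λ _ → d) (Pi₂-cong ≋-refl p λ _ _ _ → q)

  con₂∈ : ∀ {k} c {φ₁ : Val k} → con₂ c ϵ D₁ (close (typeOf c)) φ₁
  con₂∈ type  = elt∈ truth
  con₂∈ ι     = elt∈ base
  con₂∈ o     = elt∈ base
  con₂∈ arrow = Pi-lam
    (λ a a′ p → lam-cong {Types} {Types} ≋-refl λ b b′ q →
      ↦-cong {a} {a′} {b} {b′} p q)
    (λ a → Pi-lam (λ b b′ q → ↦-cong {a} {a} {b} {b′} ≋-refl q) λ b → elt∈ (a ↦ b))
  con₂∈ η     = Pi-lam (λ _ _ p → p) ty∈Sets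
  con₂∈ ⇒̇     = ∅∈Pi λ _ → ∅∈Pi λ _ → ∅∈One
  con₂∈ ∀̇     = ∅∈Pi λ _ → ∅∈Pi λ _ → ∅∈One
  con₂∈ ε     = Pi-lam (λ _ _ _ → ≋-refl) (λ _ → elt∈ unit)

  member₂ : ∀ {k} {Γ : Ctx Symbol k} {t A} → Γ ⊢ t ∶ A → ∀ {φ₁ φ₂} →
            Valid₁ Γ φ₁ → Valid₂ Γ φ₁ φ₂ → D₂ t φ₁ φ₂ ϵ D₁ A φ₁
  member₂ (⊢type w) v₁ v₂ = elt∈ truths
  member₂ (⊢var w x) v₁ v₂ = v₂ x
  member₂ (⊢con {c} w m) v₁ v₂ with refl ← ∈⇒typeOf m = con₂∈ c
  member₂ (⊢Π {A} {B} s d e) {φ₁} {φ₂} v₁ v₂ =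
    -- A code `pi` is indexed by `dom c`, whereas the codomain is interpreted over `D₁ A`; `arg`
    -- carries each index from the former to the latter.
    at (pi c f (λ i → ix (body i))) (Pi₂-cong p q λ i j r →
      ≋-trans (D₂-cong B ≗-refl (◂-≗ (≋-trans r (eq (arg j))) ≗-refl))
              (eq (body j)))
    where
    cp = member₁ d v₁
    fq = member₂ d v₁ v₂
    c = ix cp
    p = eq cp
    f = ix fq
    q = eq fq
    arg : ∀ i → elt (dom c) i ϵ D₁ A φ₁
    arg i = ∈-respʳ (≋-sym p) (elt∈ i)
    body : ∀ i → D₂ B (∅ ◂ φ₁) (elt (D₁ A φ₁) (ix (arg i)) ◂ φ₂) ϵ Sets s
    body i = member₂ e (▷₁ d v₁) (▷₂ v₂ (elt∈ (ix (arg i))))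
  member₂ (⊢ƛ {t = t} s d e f) v₁ v₂ = Pi-lam
    (λ i j p → D₂-cong t ≗-refl (◂-≗ p ≗-refl))
    (λ i → member₂ f (▷₁ d v₁) (▷₂ v₂ (elt∈ i)))
  member₂ (⊢· {B = B} {u = u} d e) v₁ v₂ = ∈-respʳ
    -- The product was formed with ∅ as the second-level value of its variable, which is indeed the
    -- value of `u`.
    (≋-trans (D₁-cong B (◂-≗ (≋-sym (value₁ e (Π-Object d) v₁)) ≗-refl))
             (≋-sym (D₁-[] u B)))
    (Pi-app′ (member₂ d v₁ v₂) (member₂ e v₁ v₂))
  member₂ (⊢conv s d e f c) v₁ v₂ =
    ∈-respʳ (↔-sound₁ v₁ d e c) (member₂ f v₁ v₂)

  η-value₂ : ∀ {x} a → x ≋ ty a → app (con₂ η) x ≋ ty a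
  η-value₂ a e = app-lam a (λ _ _ p → p) e

  ηo₂ : app (con₂ η) Truth ≋ Truth
  ηo₂ = η-value₂ base ≋-refl

  ε-value₂ : ∀ {x} → x ≋ ∅ → app (con₂ ε) x ≋ One
  ε-value₂ e = app-lam tt (λ _ _ _ → ≋-refl) e

  arrow-value₂ : ∀ {x y} a b → x ≋ ty a → y ≋ ty b →
                 app₂ (con₂ arrow) x y ≋ ty (a ↦ b)
  arrow-value₂ a b p q = ≋-trans
    (app-cong (app-lam a (λ a a′ r → lam-cong {Types} {Types} ≋-refl λ b b′ →
               ↦-cong {a} {a′} {b} {b′} r) p) ≋-refl)
    (app-lam b (λ b b′ → ↦-cong {a} {a} {b} {b′} ≋-refl) q)

  module _ {k : ℕ} {Γ : Ctx Symbol k} where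

    -- The contractum applies only η and ε to the arguments of the redex, so it is
    -- easier to type these in it.

    arrow-rule-args : ∀ {x y C} → Γ ⊢ η′ (arrow′ x y) ∶ C →
                      Γ ⊢ η′ x ∶ Type × Γ ⊢ x ∶ con type
                                      × Γ ▷ η′ x ⊢ weaken y ∶ con type
    arrow-rule-args {x} {y} d =
      let r = root (inj₂ (instantiate arrow-rule∈ (y ◂ x ◂ λ ())))
          e = subject-reduction d r
          a , _ , b = Π-inversion e
      in a , ⊢η-arg a , ⊢η-arg b

    ⇒-rule-args : ∀ {x y C} → Γ ⊢ ε′ (x ⇒′ y) ∶ C →
                  Γ ⊢ ε′ x ∶ Type × Γ ⊢ x ∶ η′ (con o)
                                  × Γ ▷ ε′ x ⊢ weaken y ∶ η′ (con o)
    ⇒-rule-args {x} {y} d =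
      let r = root (inj₂ (instantiate ⇒-rule∈ (y ◂ x ◂ λ ())))
          e = subject-reduction d r
          a , _ , b = Π-inversion e
      in a , ⊢ε-arg a , ⊢ε-arg b

    ∀-rule-args : ∀ {x y C} → Γ ⊢ ε′ (∀′ x y) ∶ C →
                  Γ ⊢ η′ x ∶ Type × Γ ⊢ x ∶ con type
                                  × Γ ▷ η′ x ⊢ weaken y · var zero ∶ η′ (con o)
    ∀-rule-args {x} {y} d =
      let r = root (inj₂ (instantiate ∀-rule∈ (y ◂ x ◂ λ ())))
          e = subject-reduction d r
          a , _ , b = Π-inversion e
      in a , ⊢η-arg a , ⊢ε-arg b

  sound₂ : ∀ {k} {Γ : Ctx Symbol k} {t u A φ₁ φ₂} → Valid₁ Γ φ₁ →
           Valid₂ Γ φ₁ φ₂ → Γ ⊢ t ∶ A → t ⟶ u → D₂ t φ₁ φ₂ ≋ D₂ u φ₁ φ₂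
  sound₂ v₁ v₂ d (root (inj₁ (beta {A} {t} {u}))) =
    let a , _ , f = β-inversion d
        at i p    = member₂ f v₁ v₂
    in ≋-trans (app-lam i (λ i j q → D₂-cong t ≗-refl (◂-≗ q ≗-refl)) p)
         (≋-sym (≋-trans (D₂-[] u t)
           (D₂-cong t (◂-≗ (value₁ f (type-Object a) v₁) ≗-refl) (◂-≗ p ≗-refl))))
  sound₂ v₁ v₂ d (root (inj₂ (instantiate arrow-rule∈ θ))) =
    let a , x∶ , y∶ = arrow-rule-args d
        at X p = member₂ x∶ v₁ v₂
        -- `y` is only known to be typed below a variable of type η x. The code `Y` is obtained at
        -- the value ∅ of that variable and fits every other one, since a weakened term does not
        -- depend on it.
        at Y q = member₂ y∶ (▷₁ a v₁) (▷₂ v₂ ∅∈One)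
        y = θ zero
    in ≋-trans
         (η-value₂ (X ↦ Y) (arrow-value₂ X Y p (≋-trans (D₂-weaken y) q)))
         (≋-sym (Pi₂-cong ≋-refl (η-value₂ X p) λ _ _ _ →
           η-value₂ Y (≋-trans (≋-sym (D₂-weaken y)) (≋-trans (D₂-weaken y) q))))
  sound₂ v₁ v₂ d (root (inj₂ (instantiate ⇒-rule∈ θ))) =
    let a , _ , y∶ = ⇒-rule-args d in
    ≋-trans (ε-value₂ (app-∅ (app-∅ ≋-refl)))
      (≋-sym (Pi-One λ i → Pi-One λ _ →
        ε-value₂ (eq (member₂ y∶ (▷₁ a v₁) (▷₂ v₂ (elt∈ i))))))
  sound₂ v₁ v₂ d (root (inj₂ (instantiate ∀-rule∈ θ))) =
    let a , _ , yz∶ = ∀-rule-args d in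
    ≋-trans (ε-value₂ (app-∅ (app-∅ ≋-refl)))
      (≋-sym (Pi-One λ i → Pi-One λ _ →
        ε-value₂ (eq (member₂ yz∶ (▷₁ a v₁) (▷₂ v₂ (elt∈ i))))))
  sound₂ v₁ v₂ d (Π₁ {B = B} r) =
    let a , _ = Π-inversion d in
    Pi₂-cong (sound₁ v₁ a r) (sound₂ v₁ v₂ a r) λ _ _ p →
    D₂-cong B ≗-refl (◂-≗ p ≗-refl)
  sound₂ v₁ v₂ d (Π₂ {A} {B} r) =
    let a , _ , b = Π-inversion d in
    Pi₂-cong ≋-refl ≋-refl λ i _ p →
    ≋-trans (D₂-cong B ≗-refl (◂-≗ p ≗-refl))
            (sound₂ (▷₁ a v₁) (▷₂ v₂ (elt∈ _)) b r)
  sound₂ v₁ v₂ d (ƛ₁ {t = t} r) =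
    let _ , a , _ = ƛ-inversion d in
    lam-cong (sound₁ v₁ a r) λ _ _ p → D₂-cong t ≗-refl (◂-≗ p ≗-refl)
  sound₂ v₁ v₂ d (ƛ₂ {A} {t} r) =
    let _ , a , b , _ = ƛ-inversion d in
    lam-cong {D₁ A _} ≋-refl λ i _ p →
    ≋-trans (D₂-cong t ≗-refl (◂-≗ p ≗-refl))
            (sound₂ (▷₁ a v₁) (▷₂ v₂ (elt∈ _)) b r)
  sound₂ v₁ v₂ d (·₁ r) = let _ , _ , e , _ = ·-inversion d in
    app-cong (sound₂ v₁ v₂ e r) ≋-refl
  sound₂ v₁ v₂ d (·₂ r) = let _ , _ , _ , e = ·-inversion d in
    app-cong ≋-refl (sound₂ v₁ v₂ e r)

  module _ {k : ℕ} {Γ : Ctx Symbol k} {φ₁ φ₂ : Val k}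
           (v₁ : Valid₁ Γ φ₁) (v₂ : Valid₂ Γ φ₁ φ₂) where
    ↔-sound₂ : ∀ {A B A′ B′} → Γ ⊢ A ∶ A′ → Γ ⊢ B ∶ B′ → A ↔ B →
               D₂ A φ₁ φ₂ ≋ D₂ B φ₁ φ₂
    ↔-sound₂ = ↔-sound (λ t → D₂ t φ₁ φ₂) (sound₂ v₁ v₂)

    ≼-sound₂ : ∀ {A B} → Γ ⊢ A ≼ B → D₂ A φ₁ φ₂ ≋ D₂ B φ₁ φ₂
    ≼-sound₂ = ≼-sound (λ t → D₂ t φ₁ φ₂) (sound₂ v₁ v₂)

  -- Fourth level

  Domain-inhabited : ∀ c → ∃[ v ] v ϵ dom c
  Domain-inhabited one     = ∅ , ∅∈One
  Domain-inhabited types   = Truth , elt∈ base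
  Domain-inhabited (c ↦ d) = let _ , p = Domain-inhabited d in
    _ , Pi-lam (λ _ _ _ → ≋-refl) (λ _ → p)

  ∅∈Family : ∀ (S : Family ⋆) → ∅ ϵ set S
  ∅∈Family truth      = ∅∈Truth
  ∅∈Family unit       = ∅∈One
  ∅∈Family (pi c d e) = ∅∈Pi λ i → ∅∈Pi λ _ → ∅∈Family (e i)

  module _ {k : ℕ} {Γ : Ctx Symbol k} {A : Tm k} {φ₁ : Val k} (d : Γ ⊢ A ∶ Type)
           (v₁ : Valid₁ Γ φ₁) where
    -- Π̃ only takes non-empty sets. As ∅ is not a member of `Types`, the witness in `D₁ A` depends
    -- on its code, whereas ∅ is a witness in every `D₂ A`.
    inhabited₁ : index (D₁ A φ₁)
    inhabited₁ = let at c e = member₁ d v₁ in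
      ix (∈-respʳ (≋-sym e) (proj₂ (Domain-inhabited c)))

    inhabited₂ : ∀ {φ₂} → Valid₂ Γ φ₁ φ₂ → index (D₂ A φ₁ φ₂)
    inhabited₂ v₂ = let at S e = member₂ d v₁ v₂ in
      ix (∈-respʳ (≋-sym e) (∅∈Family S))

  implication-cong : ∀ i i′ j j′ → elt Truth i ≋ elt Truth i′ →
                     elt Truth j ≋ elt Truth j′ →
                     sing ⟪ ∏ (value i) tt (λ _ → value j) ⟫ ≋
                     sing ⟪ ∏ (value i′) tt (λ _ → value j′) ⟫
  implication-cong i i′ j j′ p q = sing-cong
    (∏-cong (value-cong i i′ p) (sup-cong λ _ → value-cong j j′ q))

  instances-cong : ∀ a a′ f f′ z z′ →
                   elt (ty (a ↦ base)) f ≋ elt (ty (a′ ↦ base)) f′ →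
                   elt (ty a) z ≋ elt (ty a′) z′ →
                   ⟪ instances a f z ⟫ ≋ ⟪ instances a′ f′ z′ ⟫
  instances-cong a a′ f f′ z z′ p q = value-cong
    (ix (instance∈ a f z)) (ix (instance∈ a′ f′ z′))
    (≋-trans (≋-sym (eq (instance∈ a f z)))
      (≋-trans (app₂-cong p ≋-refl q) (eq (instance∈ a′ f′ z′))))

  -- The hypothesis equates the sets denoted by `a` and `a′`, not the codes, so the two families of
  -- instances have different index types and are compared through their elements.
  quantification-cong : ∀ a a′ i i′ f f′ → ty a ≋ ty a′ →
    elt Truth i ≋ elt Truth i′ → elt (ty (a ↦ base)) f ≋ elt (ty (a′ ↦ base)) f′ →
    sing ⟪ ∏ (value i) (ix (∅∈ty a)) (instances a f) ⟫ ≋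
    sing ⟪ ∏ (value i′) (ix (∅∈ty a′)) (instances a′ f′) ⟫
  quantification-cong a a′ i i′ f f′ p q r = sing-cong
    (∏-cong (value-cong i i′ q) (≋-ext
      (λ z → let at z′ e = ∈-respʳ p (elt∈ z) in
             at z′ (instances-cong a a′ f f′ z z′ r e))
      (λ z′ → let at z e = ∈-respʳ (≋-sym p) (elt∈ z′) in
              at z (instances-cong a′ a f′ f z′ z (≋-sym r) e))))

  -- Covers both `arrow`, with `D` and `S` equal to `Types`, and ⇒, with both equal to `One`.
  implication-value : ∀ {D S x y z w i j} a b → x ≋ elt D a → y ≋ elt Truth i →
    z ≋ elt S b → w ≋ elt Truth j →
    app₂ (app₂ (lam₂ D Truth λ _ i → lam₂ S Truth λ _ j →
                sing ⟪ ∏ (value i) tt (λ _ → value j) ⟫) x y) z w ≋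
    sing ⟪ ∏ (value i) tt (λ _ → value j) ⟫
  implication-value {S = S} {i = i} {j} a b p q r s = ≋-trans
    (app₂-cong (app₂-lam₂ a i (λ _ _ i i′ _ e → lam₂-cong {S} {S} {Truth} {Truth}
      ≋-refl ≋-refl λ _ _ j j′ _ → implication-cong i i′ j j′ e) p q) ≋-refl ≋-refl)
    (app₂-lam₂ b j (λ _ _ j j′ _ → implication-cong i i j j′ ≋-refl) r s)

  quantification-value : ∀ {x y z w} a i f → x ≋ ty a → y ≋ elt Truth i →
    z ≋ ∅ → w ≋ elt (ty (a ↦ base)) f →
    app₂ (app₂ (con₃ ∀̇) x y) z w ≋
    sing ⟪ ∏ (value i) (ix (∅∈ty a)) (instances a f) ⟫
  quantification-value a i f p q r s = ≋-trans
    (app₂-cong (app₂-lam₂ a i (λ a a′ i i′ e e′ →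
      lam₂-cong {One} {One} {ty (a ↦ base)} {ty (a′ ↦ base)}
        ≋-refl (↦-cong {a} {a′} {base} {base} e ≋-refl) λ _ _ f f′ _ →
        quantification-cong a a′ i i′ f f′ e e′) p q) ≋-refl ≋-refl)
    (app₂-lam₂ tt f (λ _ _ f f′ _ →
      quantification-cong a a i i f f′ ≋-refl ≋-refl) r s)

  η-value₃ : ∀ {x y} a i → x ≋ ty a → y ≋ elt Truth i →
             app₂ (con₃ η) x y ≋ ⟪ value i ⟫
  η-value₃ a i = app₂-lam₂ a i λ _ _ i i′ _ → value-cong i i′

  ε-value₃ : ∀ {x y} i → x ≋ ∅ → y ≋ elt Truth i →
             app₂ (con₃ ε) x y ≋ ⟪ value i ⟫
  ε-value₃ i = app₂-lam₂ tt i λ _ _ i i′ _ → value-cong i i′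

  con₃∈ : ∀ {k} c {φ₁ φ₂ : Val k} → con₃ c ϵ D₂ (close (typeOf c)) φ₁ φ₂
  con₃∈ type  = elt∈ ⊤̃
  con₃∈ ι     = ∅∈Truth
  con₃∈ o     = ∅∈Truth
  con₃∈ arrow = lam₂∈Pi₂
    (λ _ _ i i′ _ p → lam₂-cong {Types} {Types} {Truth} {Truth} ≋-refl ≋-refl
      λ _ _ j j′ _ → implication-cong i i′ j j′ p)
    (λ _ i → lam₂∈Pi₂ (λ _ _ j j′ _ → implication-cong i i j j′ ≋-refl)
      λ _ j → sing∈Truth _)
  con₃∈ η     = lam₂∈Pi₂ (λ _ _ i i′ _ → value-cong i i′) (λ _ i → elt∈ (value i))
  -- The value of η o is an application of a trace, equal to `Truth` only as a set.
  con₃∈ ⇒̇     = ∈-respʳ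
    (Pi₂-cong ≋-refl (≋-sym ηo₂) λ _ _ _ → Pi₂-cong ≋-refl (≋-sym ηo₂) λ _ _ _ →
     ≋-sym ηo₂)
    (lam₂∈Pi₂
      (λ _ _ i i′ _ p → lam₂-cong {One} {One} {Truth} {Truth} ≋-refl ≋-refl
        λ _ _ j j′ _ → implication-cong i i′ j j′ p)
      (λ _ i → lam₂∈Pi₂ (λ _ _ j j′ _ → implication-cong i i j j′ ≋-refl)
        λ _ j → sing∈Truth _))
  con₃∈ ∀̇     = ∈-respʳ
    (Pi₂-cong {Types} {Types} {Truth} {Truth}
      {E = λ a → Pi₂ One (ty (a ↦ base)) λ _ → Truth} ≋-refl ≋-refl λ a a′ p →
     Pi₂-cong (≋-sym (Pi-One λ _ → ≋-refl))
       (Pi₂-cong ≋-refl (≋-trans p (≋-sym (η-value₂ a′ ≋-refl))) λ _ _ _ → ≋-sym ηo₂)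
       λ _ _ _ → ≋-sym ηo₂)
    (lam₂∈Pi₂
      (λ a a′ i i′ p q → lam₂-cong {One} {One} {ty (a ↦ base)} {ty (a′ ↦ base)}
        ≋-refl (↦-cong {a} {a′} {base} {base} p ≋-refl) λ _ _ f f′ _ →
        quantification-cong a a′ i i′ f f′ p q)
      (λ a i → lam₂∈Pi₂ (λ _ _ f f′ _ →
        quantification-cong a a i i f f′ ≋-refl ≋-refl) λ _ _ → sing∈Truth _))
  con₃∈ ε     = ∈-respʳ (Pi₂-cong ≋-refl (≋-sym ηo₂) λ _ _ _ → ≋-refl)
    (lam₂∈Pi₂ (λ _ _ i i′ _ → value-cong i i′) (λ _ i → elt∈ (value i)))

  sup∈𝒜 : ∀ {I F} → I → (∀ i → F i ϵ carrier) → 𝒜 (sup I F)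
  sup∈𝒜 i p = full ((λ j → ϵ⇒∈ᵛ (p j)) , i)

  member₃ : ∀ {k} {Γ : Ctx Symbol k} {t A} → Γ ⊢ t ∶ A → ∀ {φ₁ φ₂ φ₃} →
            Valid₁ Γ φ₁ → Valid₂ Γ φ₁ φ₂ → Valid₃ Γ φ₁ φ₂ φ₃ →
            D₃ t φ₁ φ₂ φ₃ ϵ D₂ A φ₁ φ₂
  member₃ (⊢type w) v₁ v₂ v₃ = elt∈ ⊤̃
  member₃ (⊢var w x) v₁ v₂ v₃ = v₃ x
  member₃ (⊢con {c} w m) v₁ v₂ v₃ with refl ← ∈⇒typeOf m = con₃∈ c
  member₃ (⊢Π s d e) v₁ v₂ v₃ = at _ (Product-value
    (≋-sym (eq (member₃ d v₁ v₂ v₃)))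
    (sup∈𝒜 (inhabited₁ d v₁ , inhabited₂ d v₁ v₂)
      λ (i , j) → member₃ e (▷₁ d v₁) (▷₂ v₂ (elt∈ i)) (▷₃ v₃ (elt∈ j))))
  member₃ (⊢ƛ {t = t} s d e f) v₁ v₂ v₃ = lam₂∈Pi₂
    (λ _ _ _ _ p q → D₃-cong t ≗-refl (◂-≗ p ≗-refl) (◂-≗ q ≗-refl))
    (λ i j → member₃ f (▷₁ d v₁) (▷₂ v₂ (elt∈ i)) (▷₃ v₃ (elt∈ j)))
  member₃ (⊢· {B = B} {u = u} d e) v₁ v₂ v₃ =
    let at i p = member₂ e v₁ v₂ in ∈-respʳ
    (≋-trans (D₂-cong B (◂-≗ (≋-sym (value₁ e (Π-Object d) v₁)) ≗-refl)
                        (◂-≗ (≋-sym p) ≗-refl))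
             (≋-sym (D₂-[] u B)))
    (app₂∈ (member₃ d v₁ v₂ v₃) (at i p) (member₃ e v₁ v₂ v₃))
  member₃ (⊢conv s d e f c) v₁ v₂ v₃ =
    ∈-respʳ (↔-sound₂ v₁ v₂ d e c) (member₃ f v₁ v₂ v₃)

  -- Truth values and the rewrite rules

  Product-∏ : ∀ {a v S} {I : Set} (i : I) (f : I → El) → v ≋ ⟪ a ⟫ →
              S ≋ members f → Product v S ≋ ⟪ ∏ a i f ⟫
  Product-∏ i f e e′ = ≋-trans (Product-cong ≋-refl e′)
    (Product-value (≋-sym e) (full (members-𝒫⁺ i f)))

  -- A non-dependent codomain contributes a single truth value, attained because both domains are
  -- inhabited.
  image-const : ∀ {D S F a} → index D → index S → (∀ i j → F i j ≋ ⟪ a ⟫) →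
                image D S F ≋ members {⊤} (λ _ → a)
  image-const i j e = ≋-ext (λ (i , j) → at tt (e i j))
                            (λ _ → at (i , j) (≋-sym (e i j)))

  module _ {k : ℕ} {Γ : Ctx Symbol k} {x y : Tm k} {φ₁ φ₂ φ₃ : Val k}
           (v₁ : Valid₁ Γ φ₁) (v₂ : Valid₂ Γ φ₁ φ₂) (v₃ : Valid₃ Γ φ₁ φ₂ φ₃)
           where

    arrow-sound₃ : ∀ {A} → Γ ⊢ η′ (arrow′ x y) ∶ A →
      D₃ (η′ (arrow′ x y)) φ₁ φ₂ φ₃ ≋ D₃ (η′ x ⇛ η′ y) φ₁ φ₂ φ₃
    arrow-sound₃ d =
      let a , x∶ , y∶ = arrow-rule-args d
          at X p  = member₂ x∶ v₁ v₂
          at i p′ = member₃ x∶ v₁ v₂ v₃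
          ∅∈      = ∈-respʳ (≋-sym (η-value₂ X p)) (∅∈ty X)
          w₁      = ▷₁ a v₁
          w₂      = ▷₂ v₂ ∅∈One
          w₃      = ▷₃ v₃ ∅∈
          at Y q  = member₂ y∶ w₁ w₂
          at j q′ = member₃ y∶ w₁ w₂ w₃
          q₂      = ≋-trans (D₂-weaken y) q
          q₃      = ≋-trans (D₃-weaken y) q′
      in ≋-trans
           -- `arrow` returns the name `just` of an implication, which η turns back into the
           -- implication itself.
           (η-value₃ (X ↦ Y) (just (∏ (value i) tt (λ _ → value j)))
             (arrow-value₂ X Y p q₂) (implication-value X Y p p′ q₂ q₃))
           (≋-sym (Product-∏ tt (λ _ → value j) (η-value₃ X i p p′)
             (image-const {One} {D₂ (η′ x) φ₁ φ₂} tt (ix ∅∈) λ _ _ → η-value₃ Y j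
               (≋-trans (≋-sym (D₂-weaken y)) q₂)
               (≋-trans (≋-sym (D₃-weaken y)) q₃))))

    ⇒-sound₃ : ∀ {A} → Γ ⊢ ε′ (x ⇒′ y) ∶ A →
      D₃ (ε′ (x ⇒′ y)) φ₁ φ₂ φ₃ ≋ D₃ (ε′ x ⇛ ε′ y) φ₁ φ₂ φ₃
    ⇒-sound₃ d =
      let a , x∶ , y∶ = ⇒-rule-args d
          p       = eq (member₂ x∶ v₁ v₂)
          at i p′ = ∈-respʳ ηo₂ (member₃ x∶ v₁ v₂ v₃)
          ∅∈      = ∈-respʳ (≋-sym (ε-value₂ p)) ∅∈One
          w₁      = ▷₁ a v₁
          w₂      = ▷₂ v₂ ∅∈One
          w₃      = ▷₃ v₃ ∅∈
          q       = ≋-trans (D₂-weaken y) (eq (member₂ y∶ w₁ w₂))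
          at j q′ = ∈-respʳ ηo₂ (member₃ y∶ w₁ w₂ w₃)
          q₃      = ≋-trans (D₃-weaken y) q′
      in ≋-trans
           (ε-value₃ (just (∏ (value i) tt (λ _ → value j)))
             (app-∅ (app-∅ ≋-refl)) (implication-value tt tt p p′ q q₃))
           (≋-sym (Product-∏ tt (λ _ → value j) (ε-value₃ i p p′)
             (image-const {One} {D₂ (ε′ x) φ₁ φ₂} tt (ix ∅∈) λ _ _ → ε-value₃ j
               (≋-trans (≋-sym (D₂-weaken y)) q)
               (≋-trans (≋-sym (D₃-weaken y)) q₃))))

    -- The domain of the function y is recovered from the typing of y z.
    predicate : ∀ X → D₂ x φ₁ φ₂ ≋ ty X → Γ ⊢ η′ x ∶ Type →
                Γ ▷ η′ x ⊢ weaken y · var zero ∶ η′ (con o) →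
                D₂ y φ₁ φ₂ ≋ ∅ × D₃ y φ₁ φ₂ φ₃ ϵ ty (X ↦ base)
    predicate X p a yz∶ =
      let _ , _ , y∶ , z∶ = ·-inversion yz∶
          c   = var-inversion z∶
          w₁  = ▷₁ a v₁
          w₂  = ▷₂ {Γ = Γ} {η′ x} {a = ∅} v₂ ∅∈One
          ∅∈  = ∈-respʳ (≋-sym (η-value₂ X p)) (∅∈ty X)
          e₁  = ≋-sym (≼-sound₁ w₁ c)
          e₂  = ≋-trans (≋-sym (≼-sound₂ w₁ w₂ c))
                  (≋-trans (≋-sym (D₂-weaken (η′ x))) (η-value₂ X p))
          y₂∈ = member₂ y∶ w₁ w₂
          y₃∈ = member₃ y∶ w₁ w₂ (▷₃ v₃ ∅∈)
      -- By `e₁` the domain of `y` has the single element ∅. There `y` takes the value of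
      -- `weaken y · var zero`, which is ∅ because its type is η o.
      in ≋-trans (D₂-weaken y) (≋-trans (Pi-η y₂∈) (lam-∅ λ i →
           ≋-trans (app-cong ≋-refl (∈One (elt∈ i) e₁))
                   (eq (member₂ yz∶ w₁ w₂))))
       , ∈-respʳ (Pi₂-cong e₁ e₂ λ _ _ _ → ≋-refl)
           (∈-respˡ (D₃-weaken y) (Pi₂-intro y₃∈ λ i j →
             ∈-respˡ
               (app₂-cong (≋-trans (≋-sym (D₃-weaken y)) (D₃-weaken y))
                 (∈One (elt∈ i) e₁) ≋-refl)
               (∈-respʳ ηo₂ (member₃ yz∶ w₁ w₂
                 (▷₃ v₃ (∈-respʳ (≋-trans e₂ (≋-sym (η-value₂ X p)))
                                 (elt∈ j)))))))

    ∀-sound₃ : ∀ {A} → Γ ⊢ ε′ (∀′ x y) ∶ A →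
      D₃ (ε′ (∀′ x y)) φ₁ φ₂ φ₃ ≋
      D₃ (Π (η′ x) (ε′ (weaken y · var zero))) φ₁ φ₂ φ₃
    ∀-sound₃ d =
      let a , x∶ , yz∶ = ∀-rule-args d
          at X p    = member₂ x∶ v₁ v₂
          at i p′   = member₃ x∶ v₁ v₂ v₃
          y₂ , y₃∈  = predicate X p a yz∶
          at f y₃   = y₃∈
          ηx        = η-value₂ X p
          instance≋ = λ j z (e : elt (app (con₂ η) (D₂ x φ₁ φ₂)) j ≋ elt (ty X) z) →
            ε-value₃ (ix (instance∈ X f z))
              (eq (member₂ yz∶ (▷₁ a v₁) (▷₂ v₂ ∅∈One)))
              (≋-trans (app₂-cong (≋-trans (≋-sym (D₃-weaken y)) y₃) ≋-refl e)
                       (eq (instance∈ X f z)))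
      in ≋-trans
           (ε-value₃ (just (∏ (value i) (ix (∅∈ty X)) (instances X f)))
             (app-∅ (app-∅ ≋-refl)) (quantification-value X i f p p′ y₂ y₃))
           (≋-sym (Product-∏ (ix (∅∈ty X)) (instances X f) (η-value₃ X i p p′)
             -- The image ranges over `One` and the value of η x. The latter has the same elements
             -- as `ty X`, so its members are matched one by one with the instances.
             (≋-ext
               (λ (_ , j) → let at z e = ∈-respʳ ηx (elt∈ j) in
                            at z (instance≋ j z e))
               (λ z → let at j e = ∈-respʳ (≋-sym ηx) (elt∈ z) in
                      at (tt , j) (≋-sym (instance≋ j z (≋-sym e)))))))

  sound₃ : ∀ {k} {Γ : Ctx Symbol k} {t u A φ₁ φ₂ φ₃} → Valid₁ Γ φ₁ →
           Valid₂ Γ φ₁ φ₂ → Valid₃ Γ φ₁ φ₂ φ₃ → Γ ⊢ t ∶ A → t ⟶ u →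
           D₃ t φ₁ φ₂ φ₃ ≋ D₃ u φ₁ φ₂ φ₃
  sound₃ v₁ v₂ v₃ d (root (inj₁ (beta {A} {t} {u}))) =
    let a , _ , f = β-inversion d
        at i p    = member₂ f v₁ v₂
        at j q    = member₃ f v₁ v₂ v₃
    in ≋-trans
         (app₂-lam₂ i j (λ _ _ _ _ e e′ →
           D₃-cong t ≗-refl (◂-≗ e ≗-refl) (◂-≗ e′ ≗-refl)) p q)
         (≋-sym (≋-trans (D₃-[] u t)
           (D₃-cong t (◂-≗ (value₁ f (type-Object a) v₁) ≗-refl)
                      (◂-≗ p ≗-refl) (◂-≗ q ≗-refl))))
  sound₃ v₁ v₂ v₃ d (root (inj₂ (instantiate arrow-rule∈ θ))) =
    arrow-sound₃ v₁ v₂ v₃ d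
  sound₃ v₁ v₂ v₃ d (root (inj₂ (instantiate ⇒-rule∈ θ))) =
    ⇒-sound₃ v₁ v₂ v₃ d
  sound₃ v₁ v₂ v₃ d (root (inj₂ (instantiate ∀-rule∈ θ))) =
    ∀-sound₃ v₁ v₂ v₃ d
  sound₃ v₁ v₂ v₃ d (Π₁ {B = B} r) =
    let a , _ = Π-inversion d in
    Product-cong (sound₃ v₁ v₂ v₃ a r)
      (image-cong (sound₁ v₁ a r) (sound₂ v₁ v₂ a r) λ _ _ _ _ p q →
       D₃-cong B ≗-refl (◂-≗ p ≗-refl) (◂-≗ q ≗-refl))
  sound₃ v₁ v₂ v₃ d (Π₂ {A} {B} r) =
    let a , _ , b = Π-inversion d in
    Product-cong ≋-refl (sup-cong λ (i , j) →
      sound₃ (▷₁ a v₁) (▷₂ v₂ (elt∈ i)) (▷₃ v₃ (elt∈ j)) b r)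
  sound₃ v₁ v₂ v₃ d (ƛ₁ {t = t} r) =
    let _ , a , _ = ƛ-inversion d in
    lam₂-cong (sound₁ v₁ a r) (sound₂ v₁ v₂ a r) λ _ _ _ _ p q →
    D₃-cong t ≗-refl (◂-≗ p ≗-refl) (◂-≗ q ≗-refl)
  sound₃ v₁ v₂ v₃ d (ƛ₂ {A} {t} r) =
    let _ , a , b , _ = ƛ-inversion d in
    lam₂-cong {D₁ A _} {_} {D₂ A _ _} ≋-refl ≋-refl λ _ _ _ _ p q →
    ≋-trans (D₃-cong t ≗-refl (◂-≗ p ≗-refl) (◂-≗ q ≗-refl))
            (sound₃ (▷₁ a v₁) (▷₂ v₂ (elt∈ _)) (▷₃ v₃ (elt∈ _)) b r)
  sound₃ v₁ v₂ v₃ d (·₁ r) = let _ , _ , e , _ = ·-inversion d in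
    app₂-cong (sound₃ v₁ v₂ v₃ e r) ≋-refl ≋-refl
  sound₃ v₁ v₂ v₃ d (·₂ r) = let _ , _ , _ , e = ·-inversion d in
    app₂-cong ≋-refl (sound₂ v₁ v₂ e r) (sound₃ v₁ v₂ v₃ e r)

  -- The model

  𝒟 : ∀ i {k} → Tm k → Valuations k i → 𝕍
  𝒟 0 t _                     = D₀ t
  𝒟 1 t (φ₁ ∷ [])             = D₁ t φ₁
  𝒟 2 t (φ₂ ∷ φ₁ ∷ [])        = D₂ t φ₁ φ₂
  𝒟 3 t (φ₃ ∷ φ₂ ∷ φ₁ ∷ [])   = D₃ t φ₁ φ₂ φ₃
  𝒟 (suc (suc (suc (suc _)))) t _ = ∅

  open Interpretation 𝒟

  data Level : ℕ → Set where
    0# : Level 0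
    1# : Level 1
    2# : Level 2
    3# : Level 3

  level : ∀ {i} → i < 4 → Level i
  level {0} _ = 0#
  level {1} _ = 1#
  level {2} _ = 2#
  level {3} _ = 3#
  level {suc (suc (suc (suc _)))} (s≤s (s≤s (s≤s (s≤s ()))))

  valid : ∀ {k i} {Γ : Ctx Symbol k} {φ} {φs : Valuations k i} →
          Valid Γ (φ ∷ φs) → ∀ x → φ x ϵ 𝒟 i (lookup Γ x) φs
  valid (h ∷ _) x = ∈ᵛ⇒ϵ (h x)

  𝒟-member : ∀ {i} → Level (suc i) →
             ∀ {k} {Γ : Ctx Symbol k} {t B} → Γ ⊢ t ∶ B →
             ∀ {φ φs} → Valid Γ (φ ∷ φs) →
             𝒟 (suc i) t (φ ∷ φs) ϵ 𝒟 i B φs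
  𝒟-member 1# d {φs = []} v = member₁ d (valid v)
  𝒟-member 2# d {φs = _ ∷ []} v@(_ ∷ v₁) = member₂ d (valid v₁) (valid v)
  𝒟-member 3# d {φs = _ ∷ _ ∷ []} v@(_ ∷ v₂@(_ ∷ v₁)) =
    member₃ d (valid v₁) (valid v₂) (valid v)

  𝒟-rename : ∀ {i} → Level i →
             ∀ {j k l} (t : Tm j) {ρ : Fin j → Fin k} {σ : Fin j → Fin l} →
             ∀ {φs : Valuations k i} {ψs : Valuations l i} →
             Pointwise (λ φ ψ → ∀ x → φ (ρ x) ≈ ψ (σ x)) φs ψs →
             𝒟 i (rename ρ t) φs ≋ 𝒟 i (rename σ t) ψs
  𝒟-rename 0# t [] = ≡⇒≋ (trans (D₀-rename _ t) (sym (D₀-rename _ t)))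
  𝒟-rename 1# t (e₁ ∷ []) = ≋-trans (D₁-rename t (λ x → wrap (e₁ x)))
    (≋-sym (D₁-rename t ≗-refl))
  𝒟-rename 2# t (e₂ ∷ e₁ ∷ []) =
    ≋-trans (D₂-rename t (λ x → wrap (e₁ x)) (λ x → wrap (e₂ x)))
      (≋-sym (D₂-rename t ≗-refl ≗-refl))
  𝒟-rename 3# t (e₃ ∷ e₂ ∷ e₁ ∷ []) = ≋-trans
    (D₃-rename t (λ x → wrap (e₁ x)) (λ x → wrap (e₂ x)) (λ x → wrap (e₃ x)))
    (≋-sym (D₃-rename t ≗-refl ≗-refl ≗-refl))

  𝒟-conversion : ∀ {i} → Level i → ∀ {k} {Γ : Ctx Symbol k} {A B A′ B′} →
                 Γ ⊢ A ∶ A′ → Γ ⊢ B ∶ B′ → A ↔ B →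
                 ∀ {φs} → Valid Γ φs → 𝒟 i A φs ≋ 𝒟 i B φs
  𝒟-conversion 0# d e c v = ↔-sound D₀ sound₀ d e c
  𝒟-conversion 1# d e c {_ ∷ []} v = ↔-sound₁ (valid v) d e c
  𝒟-conversion 2# d e c {_ ∷ _ ∷ []} v@(_ ∷ v₁) =
    ↔-sound₂ (valid v₁) (valid v) d e c
  𝒟-conversion 3# d e c {φ₃ ∷ φ₂ ∷ φ₁ ∷ []} v@(_ ∷ v₂@(_ ∷ v₁)) =
    ↔-sound (λ t → D₃ t φ₁ φ₂ φ₃) (sound₃ (valid v₁) (valid v₂) (valid v)) d e c

  model : Model STT
  model = record
    -- The number of levels is `m` plus two, hence four, and the truth-value interpretation is `D₃`.
    { m            = 2
    ; 𝒟            = 𝒟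
    ; member       = λ i<n d v → ϵ⇒∈ᵛ (𝒟-member (level i<n) d v)
    ; local        = λ i<n t _ _ _ _ _ _ e → unwrap (𝒟-rename (level i<n) t e)
    ; substitution = λ { {t = t} {u} _ _ {_ ∷ _ ∷ _ ∷ []} _ → unwrap (D₃-[] u t) }
    }

  valuedIn : ValuedIn 𝓑 model
  valuedIn = record
    { sort-carrier = λ { _ s {_ ∷ _ ∷ []} _ → ≈-refl carrier }
    ; sort-value   = λ { _ s {_ ∷ _ ∷ _ ∷ []} _ → ≈-refl ⟪ ⊤̃ ⟫ }
    ; Π-value      = Π-value
    }
    where
    Π-value : ∀ {k} {Γ : Ctx Symbol k} {A D B} → Γ ⊢ Π A D ∶ B →
              ∀ {φs} → Valid Γ φs →
              Σ[ a ∈ El ] Σ[ S ∈ 𝕍 ] Σ[ p ∈ 𝒜 S ]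
                ⟪ a ⟫ ≈ 𝒟 3 A φs
                × (∀ v → v ∈ᵛ S ⇔ (∃[ cs ] Range A φs cs
                                          × v ≈ 𝒟 3 D (extend φs cs)))
                × 𝒟 3 (Π A D) φs ≈ ⟪ Π̃ a S p ⟫
    Π-value {A = A} {D} d {φ₃ ∷ φ₂ ∷ φ₁ ∷ []} v@(_ ∷ v₂@(_ ∷ v₁)) =
      ix A∈ , S , S∈𝒜 , unwrap (≋-sym (eq A∈)) , (λ w → mk⇔ to from) ,
      unwrap (Product-value (≋-sym (eq A∈)) S∈𝒜)
      where
      a = proj₁ (Π-inversion d)
      b = proj₂ (proj₂ (Π-inversion d))
      D₀A : D₀ A ≡ One
      D₀A = D₀-Object (type-Object a)
      A∈ = member₃ a (valid v₁) (valid v₂) (valid v)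
      S : 𝕍
      S = image (D₁ A φ₁) (D₂ A φ₁ φ₂) λ i j →
          D₃ D (∅ ◂ φ₁) (elt (D₁ A φ₁) i ◂ φ₂) (elt (D₂ A φ₁ φ₂) j ◂ φ₃)
      S∈𝒜 : 𝒜 S
      S∈𝒜 = sup∈𝒜 (inhabited₁ a (valid v₁) , inhabited₂ a (valid v₁) (valid v₂))
        λ (i , j) → member₃ b (▷₁ a (valid v₁)) (▷₂ (valid v₂) (elt∈ i))
                              (▷₃ (valid v) (elt∈ j))
      to : ∀ {w} → w ∈ᵛ S → ∃[ cs ] Range A (φ₃ ∷ φ₂ ∷ φ₁ ∷ []) cs
           × w ≈ 𝒟 3 D (extend (φ₃ ∷ φ₂ ∷ φ₁ ∷ []) cs)
      to ((i , j) , e) = elt (D₂ A φ₁ φ₂) j ∷ elt (D₁ A φ₁) i ∷ ∅ ∷ [] ,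
        (j , ≈-refl _) ∷ (i , ≈-refl _) ∷
        ϵ⇒∈ᵛ (∈-respʳ (≡⇒≋ (sym D₀A)) ∅∈One) ∷ [] , e
      from : ∀ {w} → ∃[ cs ] Range A (φ₃ ∷ φ₂ ∷ φ₁ ∷ []) cs
             × w ≈ 𝒟 3 D (extend (φ₃ ∷ φ₂ ∷ φ₁ ∷ []) cs) → w ∈ᵛ S
      from (_ ∷ _ ∷ _ ∷ [] , (j , p₃) ∷ (i , p₂) ∷ p₁ ∷ [] , e) =
        -- The value of the first level ranges over `D₀ A`, which is `One`, so it is the ∅ used by
        -- `D₃`.
        (i , j) , unwrap (≋-trans (wrap e) (D₃-cong D
          (◂-≗ (∈One (∈ᵛ⇒ϵ p₁) (≡⇒≋ D₀A)) ≗-refl)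
          (◂-≗ (wrap p₂) ≗-refl) (◂-≗ (wrap p₃) ≗-refl)))

  -- Truth of the declared types

  module ≤ = IsPreorder isPreorder

  True : 𝕍 → Set
  True v = ∃[ a ] ⟪ a ⟫ ≈ v × ⊤̃ ≤ a

  True-resp : ∀ {v w} → v ≋ w → True w → True v
  True-resp e (a , p , q) = a , unwrap (≋-trans (wrap p) (≋-sym e)) , q

  True⇒∈ : ∀ {v} → True v → v ϵ carrier
  True⇒∈ (a , p , _) = at a (≋-sym (wrap p))

  True-⊤̃ : True ⟪ ⊤̃ ⟫
  True-⊤̃ = ⊤̃ , ≈-refl ⟪ ⊤̃ ⟫ , ≤.refl

  -- By the defining property of Π̃ it suffices that the meet of ⊤̃ and `b` is below each `c` of the
  -- set; the meet is below ⊤̃, and ⊤̃ is below `c`.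
  True-Product : ∀ {v I F} → v ϵ carrier → I → (∀ i → True (F i)) →
                 True (Product v (sup I F))
  True-Product {I = I} {F} (at b e) i p =
    _ , unwrap (≋-sym (Product-value (≋-sym e) q)) ,
    Equivalence.from (Π̃-spec ⊤̃ b (sup I F) q) λ c (j , e) →
      let a , e′ , r = p j in
      ≤.trans (proj₁ (∧-infimum ⊤̃ b))
        (≤.trans r (≤.reflexive (≈-trans _ _ _ e′ (≈-sym _ _ e))))
    where
    q : 𝒜 (sup I F)
    q = sup∈𝒜 i λ j → True⇒∈ (p j)

  True-ηo : True (app₂ (con₃ η) Truth ∅)
  -- The constant o has the value ∅, which is the name `nothing` of ⊤̃.
  True-ηo = True-resp (η-value₃ base nothing ≋-refl ≋-refl) True-⊤̃

  ∅∈ηo : ∅ ϵ app (con₂ η) Truth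
  ∅∈ηo = ∈-respʳ (≋-sym ηo₂) ∅∈Truth

  -- Each declared type ends in `Type`, `type` or η o, which are true, and a product of true values
  -- is true whatever its domain. The pairs witness that the domains are inhabited.
  True-typeOf : ∀ c {φ₁ φ₂ φ₃} → True (D₃ (typeOf c) φ₁ φ₂ φ₃)
  True-typeOf type  = True-⊤̃
  True-typeOf ι     = True-⊤̃
  True-typeOf o     = True-⊤̃
  True-typeOf arrow =
    True-Product (elt∈ ⊤̃) (base , nothing) λ _ →
    True-Product (elt∈ ⊤̃) (base , nothing) λ _ → True-⊤̃
  True-typeOf η     = True-Product (elt∈ ⊤̃) (base , nothing) λ _ → True-⊤̃
  True-typeOf ⇒̇     =
    True-Product (True⇒∈ True-ηo) (tt , ix ∅∈ηo) λ _ →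
    True-Product (True⇒∈ True-ηo) (tt , ix ∅∈ηo) λ _ → True-ηo
  True-typeOf ∀̇     = True-Product (elt∈ ⊤̃) (base , nothing) λ (a , i) →
    True-Product
      (True⇒∈ (True-Product (at (value i) (η-value₃ a i ≋-refl ≋-refl))
        (tt , ix (∈-respʳ (≋-sym (η-value₂ a ≋-refl)) (∅∈ty a))) λ _ → True-ηo))
      (ix (∅∈Pi λ _ → ∅∈One) , ix (∅∈Pi λ _ → ∅∈Pi λ _ → ∅∈ηo)) λ _ → True-ηo
  True-typeOf ε     = True-Product (True⇒∈ True-ηo) (tt , ix ∅∈ηo) λ _ → True-⊤̃

  modelOf : ModelOf 𝓑 model
  modelOf = record
    { constants  = constants
    ; conversion = λ i<n d e c v → unwrap (𝒟-conversion (level i<n) d e c v)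
    }
    where
    constants : ∀ {c A} → (c , A) ∈ STT-signature → ∀ φs →
                True (𝒟 3 A φs)
    constants {c} m (_ ∷ _ ∷ _ ∷ []) with refl ← ∈⇒typeOf m = True-typeOf c

theorem4p2 : Theory.ConfluentReduction STT
    → Theory.SubjectReduction STT
    → SuperConsistent STT
theorem4p2 confluent subject-reduction 𝓑 full _ _ = model , valuedIn , modelOf
  where open Soundness 𝓑 full confluent subject-reduction
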